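{- Let $p\ge1$ be an integer and let $a,b$ be integers with $1\le a<b\le\lfloor\frac{6p-1}{2}\rfloor$ and $a\not\equiv 0\pmod 3$, $b\not\equiv 0\pmod 3$. If $p$ is even, then the circulant graph $C_{6p}(a,b)$ is Type I. If $p$ is odd and $\gcd(a,b)=1$, then $C_{6p}(a,b)$ is Type I. (Type I here means the total chromatic number equals $5$.)
   Context: For integers $n$ and $1\le d_1<d_2<\dots<d_l\le\lfloor n/2\rfloor$, the circulant graph $C_n(d_1,\dots,d_l)$ has vertex set $\{0,1,\dots,n-1\}$, with $x$ and $y$ adjacent iff $x\equiv y\pm d_i \pmod n$ for some $i$. The paper considers four-regular circulant graphs $C_n(a,b)$ with $1\le a<b\le\lfloor\frac{n-1}{2}\rfloor$. A total coloring of a graph $G$ assigns colors to vertices and edges so that adjacent vertices receive different colors, edges sharing an endpoint receive different colors, and each edge receives a color different from its two endpoints. The total chromatic number $\chi''(G)$ is the minimum number of colors in a total coloring; always $\chi''(G)\ge\Delta(G)+1$. A graph is Type I if $\chi''(G)=\Delta(G)+1$. -}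

module Defs where

open import Data.Nat using (ℕ; zero; suc; _+_; _*_; _∸_; _%_; _<_; NonZero)
open import Data.Fin using (Fin; toℕ)
open import Data.Product using (Σ; _×_; _,_)
open import Data.Sum using (_⊎_)
open import Relation.Binary.PropositionalEquality using (_≡_; _≢_)
open import Relation.Nullary using (¬_)

-- (x - y) mod n (n = 0 has no vertices, so only n = suc m matters), for vertices x y of Z_n represented as Fin n
diffMod : (n : ℕ) → Fin n → Fin n → ℕ
diffMod (suc m) x y = (toℕ x + (suc m ∸ toℕ y)) % suc m

CircAdj : (n a b : ℕ) → Fin n → Fin n → Set
CircAdj (suc m) a b x y =
  (diffMod (suc m) x y ≡ a % suc m ⊎ diffMod (suc m) y x ≡ a % suc m)
  ⊎ (diffMod (suc m) x y ≡ b % suc m ⊎ diffMod (suc m) y x ≡ b % suc m)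

-- A total coloring of C_n(a,b) with k colors.
-- vc: vertex colors; ec x y: color of the edge {x,y} (only meaningful when
-- x,y adjacent, required symmetric so it is a function of the unordered edge).
record TotalColoring (n a b k : ℕ) : Set where
  field
    vc : Fin n → Fin k
    ec : Fin n → Fin n → Fin k
    ec-sym   : ∀ x y → CircAdj n a b x y → ec x y ≡ ec y x
    vert-ok  : ∀ x y → CircAdj n a b x y → vc x ≢ vc y
    inc-ok   : ∀ x y → CircAdj n a b x y → ec x y ≢ vc x
    edge-ok  : ∀ x y z → CircAdj n a b x y → CircAdj n a b x z → y ≢ z →
               ec x y ≢ ec x z

TotalChromaticNumber : (n a b k : ℕ) → Set
TotalChromaticNumber n a b k =
  TotalColoring n a b k × (∀ j → j < k → ¬ TotalColoring n a b j)

-- Type I for the 4-regular C_n(a,b): χ'' = Δ + 1 = 5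
TypeI₄ : (n a b : ℕ) → Set
TypeI₄ n a b = TotalChromaticNumber n a b 5

{-# OPTIONS --safe #-}

-- Work in a connected component, with signs such that a ≡ b ≡ 1 (mod 3); let m be its order.
-- Colour x by x mod 3 and the a-edges by the third colour: the b-edges form cycles on which
-- colours 3 and 4 must alternate, which is possible if m is even (and b, say, is odd).
-- Let m be odd and e = gcd (m, a - b), a multiple of 3. Every edge joins consecutive ones of the
-- e cosets of a - b; if e > 3, some colouring depends on the coset only.
-- If e = 3, cover the vertices by cycles that use a-edges on one of the three layers and b-edges
-- on the others; the remaining edges have the colour missing at their ends. Let σ and π denote
-- the steps along the cycles and along the remaining edges. Where both cycle edges at a vertex v
-- of layer 0 have colour 3, recolour v by 4 and exchange the colours 0 and 3 on the Kempe chain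
-- v, σ v, π σ v, σ π σ v, whose end takes colour 3. Positions of these defects with disjoint
-- chains exist unless a ≡ -2b or b ≡ -2a (mod m); then the component is C_m(1, 2).

module Submission where

open import Defs

module Construction where

  open import Data.Bool using (Bool; true; false; if_then_else_; _∧_; _∨_; not)
  import Data.Bool.Properties as Bool
  open import Data.Fin as Fin using (Fin; zero; suc; toℕ; fromℕ<; #_)
  open import Data.Fin.Patterns
  import Data.Fin.Properties as Fin
  open import Data.Integer using (ℤ; +_; -[1+_]; _+_; _-_; _*_; -_; ∣_∣; _%ℕ_; _/ℕ_; 0ℤ; -1ℤ; _⊖_)
  open import Data.Integer.DivMod using (n%ℕd<d; a≡a%ℕn+[a/ℕn]*n)
  open import Data.Integer.Divisibility.Signed
  import Data.Integer.Properties as ℤ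
  open import Algebra.Properties.AbelianGroup ℤ.+-0-abelianGroup using (∙-cancelˡ)
  open import Data.Integer.Tactic.RingSolver using (solve-∀)
  open import Data.List using (List; []; _∷_; lookup; upTo; allFin)
  open import Data.List.Membership.Propositional using (_∈_)
  open import Data.List.Membership.Propositional.Properties using (∈-lookup; ∈-allFin; ∈-upTo⁺)
  open import Data.List.Relation.Unary.All as All using (All; []; _∷_)
  open import Data.List.Relation.Unary.AllPairs using ([]; _∷_)
  open import Data.List.Relation.Unary.Any using (here; there)
  import Data.List.Relation.Unary.Unique.DecPropositional as DecUnique
  open import Data.List.Relation.Unary.Unique.Propositional using (Unique)
  open import Data.Nat as ℕ using (ℕ; zero; suc)
  import Data.Nat.Divisibility as ℕ
  import Data.Nat.DivMod as ℕ
  open import Data.Nat.GCD using (gcd; gcd[m,n]∣m; gcd[m,n]∣n; gcd-greatest; gcd-GCD; module Bézout)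
  open import Data.Nat.Primality using (prime?; euclidsLemma)
  import Data.Nat.Properties as ℕ
  import Data.Nat.Tactic.RingSolver as ℕSolve
  open import Data.Product using (∃; _×_; _,_; proj₁; proj₂)
  open import Data.Sum using (_⊎_; inj₁; inj₂)
  open import Data.Vec as Vec using ([]; _∷_)
  open import Relation.Binary.Definitions using (tri<; tri≈; tri>)
  open import Relation.Binary.PropositionalEquality
  open import Relation.Nullary using (¬_; Dec; yes; no; contradiction; does)
  open import Relation.Nullary.Decidable using (True; toWitness; from-yes; map′; ¬?; _×-dec_; _→-dec_)

  -- Residues of integers.

  shift-∣ : ∀ {n x y} → x ≡ y → n ∣ x → n ∣ y
  shift-∣ refl d = d

  residue-unique : ∀ m .{{_ : ℕ.NonZero m}} {x i} → i ℕ.< m → + m ∣ x - + i → x %ℕ m ≡ i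
  residue-unique m {x} {i} i<m d = ℤ.+-injective (ℤ.i-j≡0⇒i≡j _ _ (ℤ.∣i∣≡0⇒i≡0 small))
    where
    r = x %ℕ m
    r<m = n%ℕd<d x m
    m∣r-i : + m ∣ + r - + i
    m∣r-i = shift-∣ (trans (cong (λ y → y - + i - x /ℕ m * + m) (a≡a%ℕn+[a/ℕn]*n x m))
        (cancel (+ r) (x /ℕ m * + m) (+ i)))
              (∣m∣n⇒∣m-n d (divides (x /ℕ m) refl))
      where
      cancel : ∀ r q i → (r + q) - i - q ≡ r - i
      cancel = solve-∀
    small : ∣ + r - + i ∣ ≡ 0
    small with ∣ + r - + i ∣ in eq
    ... | zero = refl
    ... | suc k = contradiction (ℕ.∣⇒≤ (subst (m ℕ.∣_) eq (∣⇒∣ᵤ m∣r-i)))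
        (ℕ.<⇒≱ (subst (ℕ._< m) (trans (cong ∣_∣ (sym (ℤ.m-n≡m⊖n r i))) eq) (∣⊖∣< r<m i<m)))
      where
      ∣⊖∣< : ∀ {r i} → r ℕ.< m → i ℕ.< m → ∣ r ⊖ i ∣ ℕ.< m
      ∣⊖∣< {r} {i} r<m i<m = ℕ.≤-<-trans (ℤ.∣m⊝n∣≤m⊔n r i) (ℕ.⊔-lub r<m i<m)

  residue-∣ : ∀ m .{{_ : ℕ.NonZero m}} x → + m ∣ x - + (x %ℕ m)
  residue-∣ m x = divides (x /ℕ m) (trans (cong (_- + (x %ℕ m)) (a≡a%ℕn+[a/ℕn]*n x m))
      (cancel (+ (x %ℕ m)) _))
    where
    cancel : ∀ r q → (r + q) - r ≡ q
    cancel = solve-∀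

  residue-cong : ∀ m .{{_ : ℕ.NonZero m}} {x y} → + m ∣ x - y → x %ℕ m ≡ y %ℕ m
  residue-cong m {x} {y} d = residue-unique m {x} (n%ℕd<d y m)
      (shift-∣ (glue x y (+ (y %ℕ m))) (∣m∣n⇒∣m+n d (residue-∣ m y)))
    where
    glue : ∀ x y r → (x - y) + (y - r) ≡ x - r
    glue = solve-∀

  -- Schemes and their transformations.

  -- The colours of a vertex z, of the edge from z to z + a and of the edge from z to z + b.
  record Tile : Set where
    constructor tile
    field vertex aEdge bEdge : Fin 5
  open Tile

  -- Five colours meet at a vertex of degree four, so in a proper scheme every colour occurs exactly
  -- once in each star.
  star : Tile → Tile → Tile → List (Fin 5)
  star t u v = vertex t ∷ aEdge t ∷ aEdge u ∷ bEdge t ∷ bEdge v ∷ []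

  -- u and v are the tiles at z - a and z - b, where t is the tile at z.
  Proper : Tile → Tile → Tile → Set
  Proper t u v = Unique (star t u v) × vertex t ≢ vertex u × vertex t ≢ vertex v

  proper? : ∀ t u v → Dec (Proper t u v)
  proper? t u v = DecUnique.unique? Fin._≟_ (star t u v) ×-dec ¬? (vertex t Fin.≟ vertex u) ×-dec ¬?
      (vertex t Fin.≟ vertex v)

  -- A total colouring of C_n(a, b), where a and b may be negative, lifted to ℤ.
  record Scheme (n : ℕ) (a b : ℤ) : Set where
    field
      color    : ℤ → Tile
      periodic : ∀ {x y} → + n ∣ x - y → color x ≡ color y
      proper   : ∀ z → Proper (color z) (color (z - a)) (color (z - b))
  open Scheme

  -- Properness at `z` involves only the tiles at `z`, `z - a` and `z - b`, so `f` only has to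
  -- respect periods and these two steps. It may be neither injective nor additive: quotients and
  -- division by `g` both fit.
  pullback : ∀ {m n α β a b} (f : ℤ → ℤ) →
    (∀ {x y} → + n ∣ x - y → + m ∣ f x - f y) →
    (∀ x → + m ∣ f (x - a) - (f x - α)) →
    (∀ x → + m ∣ f (x - b) - (f x - β)) →
    Scheme m α β → Scheme n a b
  pullback f cong-f f-a f-b s .color z = s .color (f z)
  pullback f cong-f f-a f-b s .periodic d = s .periodic (cong-f d)
  pullback f cong-f f-a f-b s .proper z =
    subst₂ (Proper _) (sym (s .periodic (f-a z))) (sym (s .periodic (f-b z))) (s .proper (f z))

  scale : ∀ {m n α β a b} (w : ℤ) → + m ∣ + n → + m ∣ w * a - α → + m ∣ w * b - β →
          Scheme m α β → Scheme n a b
  scale {α = α} {β} {a} {b} w m∣n wa wb = pullback (w *_)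
    (λ {x} {y} d → shift-∣ (distrib w x y) (∣n⇒∣m*n w (∣-trans m∣n d)))
    (λ x → shift-∣ (step w x a α) (∣m⇒∣-m wa))
    (λ x → shift-∣ (step w x b β) (∣m⇒∣-m wb))
    where
    distrib : ∀ w x y → w * (x - y) ≡ w * x - w * y
    distrib = solve-∀
    step : ∀ w x a α → - (w * a - α) ≡ w * (x - a) - (w * x - α)
    step = solve-∀

  swap : ∀ {n a b} → Scheme n a b → Scheme n b a
  swap s .color z = let t = s .color z in tile (vertex t) (bEdge t) (aEdge t)
  swap s .periodic d = cong (λ t → tile (vertex t) (bEdge t) (aEdge t)) (s .periodic d)
  swap s .proper z with s .proper z
  ... | (va ∷ va′ ∷ vb ∷ vb′ ∷ []) ∷ (aa′ ∷ ab ∷ ab′ ∷ []) ∷ (a′b ∷ a′b′ ∷ []) ∷ (bb′ ∷ []) ∷ [] ∷ [] , p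
      , q =
    (vb ∷ vb′ ∷ va ∷ va′ ∷ []) ∷ (bb′ ∷ ≢-sym ab ∷ ≢-sym a′b ∷ []) ∷ (≢-sym ab′ ∷ ≢-sym a′b′ ∷ []) ∷
        (aa′ ∷ []) ∷ [] ∷ [] , q , p

  -- For the step `- a`, the edge leaving `z` is the one that arrived at `z` before, and its colour
  -- is stored at `z - a`.
  reverse : ∀ {n a b} → Scheme n a b → Scheme n (- a) b
  reverse {a = a} s .color z = tile (vertex (s .color z)) (aEdge (s .color (z - a))) (bEdge (s .color z))
  reverse {a = a} s .periodic {x} {y} d = cong₂ (λ t u → tile (vertex t) (aEdge u) (bEdge t))
    (s .periodic d) (s .periodic (shift-∣ (translate x y a) d))
    where
    translate : ∀ x y a → x - y ≡ (x - a) - (y - a)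
    translate = solve-∀
  reverse {a = a} {b} s .proper z with s .proper z | s .proper (z - - a)
  ... | (va ∷ va′ ∷ vb ∷ vb′ ∷ []) ∷ (aa′ ∷ ab ∷ ab′ ∷ []) ∷ (a′b ∷ a′b′ ∷ []) ∷ (bb′ ∷ []) ∷ [] ∷ [] , p
      , q | _ , p′ , _ =
    (va′ ∷ back-≢ va ∷ vb ∷ vb′ ∷ []) ∷ (back-≢ (≢-sym aa′) ∷ a′b ∷ a′b′ ∷ []) ∷
        (≢-back ab ∷ ≢-back ab′ ∷ []) ∷ (bb′ ∷ []) ∷ [] ∷ []
    , (λ e → p′ (trans (sym e) (cong (λ x → vertex (s .color x)) (sym (back z a))))) , q
    where
    back : ∀ z a → (z - - a) - a ≡ z
    back = solve-∀
    back-≢ : ∀ {c} → c ≢ aEdge (s .color z) → c ≢ aEdge (s .color (z - - a - a))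
    back-≢ = subst (λ x → _ ≢ aEdge (s .color x)) (sym (back z a))
    ≢-back : ∀ {c} → aEdge (s .color z) ≢ c → aEdge (s .color (z - - a - a)) ≢ c
    ≢-back p = ≢-sym (back-≢ (≢-sym p))

  -- From schemes to total colourings of the graph.

  lookup-injective : ∀ {A : Set} {xs : List A} → Unique xs → ∀ i j → lookup xs i ≡ lookup xs j → i ≡ j
  lookup-injective (x∉xs ∷ u) zero    zero    _ = refl
  lookup-injective (x∉xs ∷ u) zero    (suc j) e = contradiction e (All.lookup x∉xs (∈-lookup j))
  lookup-injective (x∉xs ∷ u) (suc i) zero    e = contradiction (sym e) (All.lookup x∉xs (∈-lookup i))
  lookup-injective (x∉xs ∷ u) (suc i) (suc j) e = cong suc (lookup-injective u i j e)

  module Circulant (k a b : ℕ) (0<a : 0 ℕ.< a) (a<b : a ℕ.< b) (2b<n : b ℕ.+ b ℕ.< suc k) where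

    n : ℕ
    n = suc k

    pos : Fin n → ℤ
    pos x = + toℕ x

    offset : Fin 4 → ℤ
    offset 0F = + a
    offset 1F = - + a
    offset 2F = + b
    offset 3F = - + b

    opposite : Fin 4 → Fin 4
    opposite 0F = 1F
    opposite 1F = 0F
    opposite 2F = 3F
    opposite 3F = 2F

    offset-opposite : ∀ i → offset (opposite i) ≡ - offset i
    offset-opposite 0F = refl
    offset-opposite 1F = sym (ℤ.neg-involutive (+ a))
    offset-opposite 2F = refl
    offset-opposite 3F = sym (ℤ.neg-involutive (+ b))

    record Edge (x y : Fin n) (i : Fin 4) : Set where
      constructor edge
      field congruent : + n ∣ pos y - (pos x + offset i)
    open Edge

    private
      b<n : b ℕ.< n
      b<n = ℕ.≤-<-trans (ℕ.m≤m+n b b) 2b<n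

      b<n∸b : b ℕ.< n ℕ.∸ b
      b<n∸b = ℕ.m+n≤o⇒m≤o∸n (suc b) 2b<n

      n∸b<n∸a : n ℕ.∸ b ℕ.< n ℕ.∸ a
      n∸b<n∸a = ℕ.∸-monoʳ-< a<b (ℕ.<⇒≤ b<n)

      n∸a<n : n ℕ.∸ a ℕ.< n
      n∸a<n = ℕ.∸-monoʳ-< 0<a (ℕ.<⇒≤ (ℕ.<-trans a<b b<n))

    residue : Fin 4 → ℕ
    residue 0F = a
    residue 1F = n ℕ.∸ a
    residue 2F = b
    residue 3F = n ℕ.∸ b

    neg-residue : ∀ {d} → d ℕ.≤ n → + n ∣ - + d - + (n ℕ.∸ d)
    neg-residue {d} d≤n = divides -1ℤ (trans (trans (sym (ℤ.neg-distrib-+ (+ d) (+ (n ℕ.∸ d))))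
      (cong (λ m → - + m) (ℕ.m+[n∸m]≡n d≤n))) (sym (ℤ.-1*i≡-i (+ n))))

    offset%n : ∀ i → offset i %ℕ n ≡ residue i
    offset%n 0F = ℕ.m<n⇒m%n≡m (ℕ.<-trans a<b b<n)
    offset%n 1F = residue-unique n {offset 1F} n∸a<n (neg-residue (ℕ.<⇒≤ (ℕ.<-trans a<b b<n)))
    offset%n 2F = ℕ.m<n⇒m%n≡m b<n
    offset%n 3F = residue-unique n {offset 3F} (ℕ.<-trans n∸b<n∸a n∸a<n) (neg-residue (ℕ.<⇒≤ b<n))

    -- The list is increasing, with b < n - b because 2 b < n. Hence the four neighbours of a vertex
    -- are distinct and an edge determines its slot.
    residues-distinct : Unique (residue 0F ∷ residue 2F ∷ residue 3F ∷ residue 1F ∷ [])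
    residues-distinct =
      (ℕ.<⇒≢ a<b ∷ ℕ.<⇒≢ a<n∸b ∷ ℕ.<⇒≢ (ℕ.<-trans a<n∸b n∸b<n∸a) ∷ []) ∷
      (ℕ.<⇒≢ b<n∸b ∷ ℕ.<⇒≢ (ℕ.<-trans b<n∸b n∸b<n∸a) ∷ []) ∷
      (ℕ.<⇒≢ n∸b<n∸a ∷ []) ∷ [] ∷ []
      where
      a<n∸b = ℕ.<-trans a<b b<n∸b

    residue-injective : ∀ i j → residue i ≡ residue j → i ≡ j
    residue-injective i j e = rank-injective i j (lookup-injective residues-distinct (rank i) (rank j)
        (trans (sym (ranked i)) (trans e (ranked j))))
      where
      rank : Fin 4 → Fin 4
      rank 0F = 0F
      rank 1F = 3F
      rank 2F = 1F
      rank 3F = 2F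
      ranked : ∀ i → residue i ≡ lookup (residue 0F ∷ residue 2F ∷ residue 3F ∷ residue 1F ∷ []) (rank i)
      ranked 0F = refl
      ranked 1F = refl
      ranked 2F = refl
      ranked 3F = refl
      unrank : Fin 4 → Fin 4
      unrank 0F = 0F
      unrank 1F = 2F
      unrank 2F = 3F
      unrank 3F = 1F
      unrank-rank : ∀ i → unrank (rank i) ≡ i
      unrank-rank 0F = refl
      unrank-rank 1F = refl
      unrank-rank 2F = refl
      unrank-rank 3F = refl
      rank-injective : ∀ i j → rank i ≡ rank j → i ≡ j
      rank-injective i j e = trans (sym (unrank-rank i)) (trans (cong unrank e) (unrank-rank j))

    offset-injective : ∀ i j → + n ∣ offset i - offset j → i ≡ j
    offset-injective i j d = residue-injective i j
      (trans (sym (offset%n i)) (trans (residue-cong n {offset i} {offset j} d) (offset%n j)))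

    pos-injective : ∀ {x y} → + n ∣ pos x - pos y → x ≡ y
    pos-injective {x} {y} d = Fin.toℕ-injective (trans (sym (ℕ.m<n⇒m%n≡m (Fin.toℕ<n x)))
      (trans (residue-cong n {pos x} {pos y} d) (ℕ.m<n⇒m%n≡m (Fin.toℕ<n y))))

    Edge-slot : ∀ {x y i j} → Edge x y i → Edge x y j → i ≡ j
    Edge-slot {x} {y} {i} {j} (edge d) (edge e) = offset-injective i j
      (shift-∣ (cancel (pos x) (pos y) (offset i) (offset j)) (∣m∣n⇒∣m-n e d))
      where
      cancel : ∀ x y i j → (y - (x + j)) - (y - (x + i)) ≡ i - j
      cancel = solve-∀

    Edge-end : ∀ {x y z i} → Edge x y i → Edge x z i → y ≡ z
    Edge-end {x} {y} {z} {i} (edge d) (edge e) = pos-injective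
        (shift-∣ (cancel (pos x) (pos y) (pos z) (offset i)) (∣m∣n⇒∣m-n d e))
      where
      cancel : ∀ x y z i → (y - (x + i)) - (z - (x + i)) ≡ y - z
      cancel = solve-∀

    Edge-sym : ∀ {x y i} → Edge x y i → Edge y x (opposite i)
    Edge-sym {x} {y} {i} (edge d) =
        edge
        (shift-∣
            (trans (flip (pos x) (pos y) (offset i))
                (cong (λ o → pos x - (pos y + o)) (sym (offset-opposite i))))
        (∣m⇒∣-m d))
      where
      flip : ∀ x y i → - (y - (x + i)) ≡ x - (y + - i)
      flip = solve-∀

    diffMod-∣ : ∀ x y → + n ∣ + diffMod n y x - (pos y - pos x)
    diffMod-∣ x y = shift-∣ (trans (cong (λ m → - (+ (toℕ y ℕ.+ (n ℕ.∸ toℕ x)) - + diffMod n y x) + m) n≡)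
        (trans (cong (λ m → - (m - + diffMod n y x) + (pos x + + (n ℕ.∸ toℕ x)))
            (ℤ.pos-+ (toℕ y) (n ℕ.∸ toℕ x)))
            (cancel (pos x) (pos y) (+ (n ℕ.∸ toℕ x)) (+ diffMod n y x))))
      (∣m∣n⇒∣m+n (∣m⇒∣-m (residue-∣ n (+ (toℕ y ℕ.+ (n ℕ.∸ toℕ x))))) ∣-refl)
      where
      n≡ : + n ≡ pos x + + (n ℕ.∸ toℕ x)
      n≡ = trans (cong +_ (sym (ℕ.m+[n∸m]≡n (ℕ.<⇒≤ (Fin.toℕ<n x))))) (ℤ.pos-+ (toℕ x) _)
      cancel : ∀ x y m d → - ((y + m) - d) + (x + m) ≡ d - (y - x)
      cancel = solve-∀

    diffMod⇒∣ : ∀ x y d → diffMod n y x ≡ d ℕ.% n → + n ∣ pos y - (pos x + + d)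
    diffMod⇒∣ x y d e =
        shift-∣ (trans (cong (λ r → - (r - (pos y - pos x)) - (+ d - + (d ℕ.% n))) (cong +_ e))
        (cancel (pos x) (pos y) (+ d) (+ (d ℕ.% n))))
        (∣m∣n⇒∣m-n (∣m⇒∣-m (diffMod-∣ x y)) (residue-∣ n (+ d)))
      where
      cancel : ∀ x y d r → - (r - (y - x)) - (d - r) ≡ y - (x + d)
      cancel = solve-∀

    ∣⇒diffMod : ∀ x y d → + n ∣ pos y - (pos x + + d) → diffMod n y x ≡ d ℕ.% n
    ∣⇒diffMod x y d e = trans (sym (ℕ.m<n⇒m%n≡m (ℕ.m%n<n (toℕ y ℕ.+ (n ℕ.∸ toℕ x)) n)))
        (residue-cong n {+ diffMod n y x} {+ d} (shift-∣ (cancel (pos x) (pos y) (+ d) (+ diffMod n y x))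
            (∣m∣n⇒∣m+n (diffMod-∣ x y) e)))
      where
      cancel : ∀ x y d r → (r - (y - x)) + (y - (x + d)) ≡ r - d
      cancel = solve-∀

    adjacent⇒edge : ∀ x y → CircAdj n a b x y → ∃ (Edge x y)
    adjacent⇒edge x y (inj₁ (inj₁ e)) = 1F , Edge-sym (edge {i = 0F} (diffMod⇒∣ y x a e))
    adjacent⇒edge x y (inj₁ (inj₂ e)) = 0F , edge (diffMod⇒∣ x y a e)
    adjacent⇒edge x y (inj₂ (inj₁ e)) = 3F , Edge-sym (edge {i = 2F} (diffMod⇒∣ y x b e))
    adjacent⇒edge x y (inj₂ (inj₂ e)) = 2F , edge (diffMod⇒∣ x y b e)

    edge⇒adjacent : ∀ {x y i} → Edge x y i → CircAdj n a b x y
    edge⇒adjacent {x} {y} {0F} e = inj₁ (inj₂ (∣⇒diffMod x y a (e .congruent)))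
    edge⇒adjacent {x} {y} {1F} e = inj₁ (inj₁ (∣⇒diffMod y x a (Edge-sym e .congruent)))
    edge⇒adjacent {x} {y} {2F} e = inj₂ (inj₂ (∣⇒diffMod x y b (e .congruent)))
    edge⇒adjacent {x} {y} {3F} e = inj₂ (inj₁ (∣⇒diffMod y x b (Edge-sym e .congruent)))

    module _ (s : Scheme n (+ a) (+ b)) where

      palette : ℤ → List (Fin 5)
      palette z = star (s .color z) (s .color (z - + a)) (s .color (z - + b))

      slot : ℤ → Fin 4 → Fin 5
      -- `suc` skips the colour of the vertex; the other entries of `star` come in the order of
      -- `offset`.
      slot z i = lookup (palette z) (suc i)

      step-back : ∀ y z d → y - (z + d) ≡ (y - d) - z
      step-back = solve-∀

      -- An edge colour is stored only at the start of its positive step, and the slots at both ends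
      -- read that same entry.
      slot-opposite : ∀ {y z} i → + n ∣ y - (z + offset i) → slot y (opposite i) ≡ slot z i
      slot-opposite {y} {z} 0F d = cong aEdge (s .periodic (shift-∣ (step-back y z (+ a)) d))
      slot-opposite 1F d = cong aEdge (s .periodic d)
      slot-opposite {y} {z} 2F d = cong bEdge (s .periodic (shift-∣ (step-back y z (+ b)) d))
      slot-opposite 3F d = cong bEdge (s .periodic d)

      vertex-≢ : ∀ {y z} i → + n ∣ y - (z + offset i) → vertex (s .color z) ≢ vertex (s .color y)
      vertex-≢ {y} {z} 0F d e = s .proper y .proj₂ .proj₁
          (trans (sym e) (cong vertex (sym (s .periodic (shift-∣ (step-back y z (+ a)) d)))))
      vertex-≢ {y} {z} 1F d e = s .proper z .proj₂ .proj₁ (trans e (cong vertex (s .periodic d)))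
      vertex-≢ {y} {z} 2F d e = s .proper y .proj₂ .proj₂
          (trans (sym e) (cong vertex (sym (s .periodic (shift-∣ (step-back y z (+ b)) d)))))
      vertex-≢ {y} {z} 3F d e = s .proper z .proj₂ .proj₂ (trans e (cong vertex (s .periodic d)))

      edge? : ∀ x y → Dec (∃ (Edge x y))
      edge? x y = Fin.any? (λ i → map′ edge congruent (+ n ∣? pos y - (pos x + offset i)))

      edgeColor : Fin n → Fin n → Fin 5
      edgeColor x y with edge? x y
      ... | yes (i , _) = slot (pos x) i
      -- An arbitrary value: only the colours of adjacent pairs are constrained.
      ... | no _ = 0F

      edgeColor-slot : ∀ {x y i} → Edge x y i → edgeColor x y ≡ slot (pos x) i
      edgeColor-slot {x} {y} {i} d with edge? x y
      ... | yes (j , e) = cong (slot (pos x)) (Edge-slot e d)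
      ... | no ¬e = contradiction (i , d) ¬e

      totalColoring : TotalColoring n a b 5
      totalColoring .TotalColoring.vc x = vertex (s .color (pos x))
      totalColoring .TotalColoring.ec = edgeColor
      totalColoring .TotalColoring.ec-sym x y adj
        with i , e ← adjacent⇒edge x y adj =
        trans (edgeColor-slot e)
            (trans (sym (slot-opposite i (e .congruent))) (sym (edgeColor-slot (Edge-sym e))))
      totalColoring .TotalColoring.vert-ok x y adj
        with i , e ← adjacent⇒edge x y adj = vertex-≢ i (e .congruent)
      totalColoring .TotalColoring.inc-ok x y adj eq
        with i , e ← adjacent⇒edge x y adj
        with () ← lookup-injective (s .proper (pos x) .proj₁) (suc i) 0F
            (trans (sym (edgeColor-slot e)) eq)
      totalColoring .TotalColoring.edge-ok x y z adj adj′ y≢z eq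
        with i , e ← adjacent⇒edge x y adj | j , e′ ← adjacent⇒edge x z adj′
        with refl ← lookup-injective (s .proper (pos x) .proj₁) (suc i) (suc j)
               (trans (sym (edgeColor-slot e)) (trans eq (edgeColor-slot e′)))
        = y≢z (Edge-end e e′)

    -- The lower bound.

    neighbour : Fin 4 → Fin n
    neighbour i = fromℕ< (n%ℕd<d (offset i) n)

    neighbour-edge : ∀ i → Edge 0F (neighbour i) i
    neighbour-edge i =
        edge
        (shift-∣
            (trans (flip (offset i) _)
                (cong (λ r → + r - (0ℤ + offset i)) (sym (Fin.toℕ-fromℕ< (n%ℕd<d (offset i) n)))))
      (∣m⇒∣-m (residue-∣ n (offset i))))
      where
      flip : ∀ i r → - (i - r) ≡ r - (0ℤ + i)
      flip = solve-∀

    -- The vertex 0 and its four edges conflict pairwise, so their colours would inject `Fin 5` into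
    -- `Fin j`.
    ¬totalColoring : ∀ j → j ℕ.< 5 → ¬ TotalColoring n a b j
    ¬totalColoring j j<5 t = Fin.<⇒notInjective {f = f} j<5 (λ {x} {y} → f-injective x y)
      where
      open TotalColoring t
      adj : ∀ i → CircAdj n a b 0F (neighbour i)
      adj i = edge⇒adjacent (neighbour-edge i)
      f : Fin 5 → Fin j
      f zero    = vc 0F
      f (suc i) = ec 0F (neighbour i)
      f-injective : ∀ x y → f x ≡ f y → x ≡ y
      f-injective zero    zero    e = refl
      f-injective zero    (suc y) e = contradiction (sym e) (inc-ok 0F (neighbour y) (adj y))
      f-injective (suc x) zero    e = contradiction e (inc-ok 0F (neighbour x) (adj x))
      f-injective (suc x) (suc y) e with neighbour x Fin.≟ neighbour y
      ... | yes eq = cong suc (Edge-slot (subst (λ v → Edge 0F v x) eq (neighbour-edge x))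
          (neighbour-edge y))
      ... | no neq = contradiction e (edge-ok 0F _ _ (adj x) (adj y) neq)

    scheme⇒typeI : Scheme n (+ a) (+ b) → TypeI₄ n a b
    scheme⇒typeI s = totalColoring s , ¬totalColoring

  -- Colourings from tables

  -- Negative steps place the predecessors at `i + α` and `i + β`, which avoids subtraction of
  -- residues; properness of the table is then decided by evaluation.
  tabulated : ∀ n .{{_ : ℕ.NonZero n}} (t : ℕ → Tile) (α β : ℕ)
    {_ : True (All.all? (λ i → proper? (t i) (t ((i ℕ.+ α) ℕ.% n)) (t ((i ℕ.+ β) ℕ.% n))) (upTo n))} →
    Scheme n (- + α) (- + β)
  tabulated n t α β {ok} = record
    { color    = λ z → t (z %ℕ n)
    ; periodic = λ {x} {y} d → cong t (residue-cong n {x} {y} d)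
    ; proper   = λ z → subst₂ (Proper _) (cong t (sym (shift z α))) (cong t (sym (shift z β)))
                         (All.lookup (toWitness ok) (∈-upTo⁺ (n%ℕd<d z n)))
    }
    where
    shift : ∀ z d → (z - - + d) %ℕ n ≡ (z %ℕ n ℕ.+ d) ℕ.% n
    shift z d = residue-cong n {z - - + d} {+ (z %ℕ n ℕ.+ d)}
        (shift-∣
            (trans (cancel z (+ (z %ℕ n)) (+ d))
            (cong (λ m → (z - - + d) - m) (sym (ℤ.pos-+ (z %ℕ n) d)))) (residue-∣ n z))
      where
      cancel : ∀ z r d → z - r ≡ (z - - d) - (r + d)
      cancel = solve-∀

  sixTiles : ℕ → Tile
  sixTiles 0 = tile 0F 2F 3F
  sixTiles 1 = tile 1F 0F 4F
  sixTiles 2 = tile 2F 1F 3F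
  sixTiles 3 = tile 0F 2F 4F
  sixTiles 4 = tile 1F 0F 3F
  sixTiles _ = tile 2F 1F 4F

  -- Modulo 6 the steps are 1 and 1 here, 4 and 1 in `six⁻`. Given a ≡ b ≡ 1 (mod 3) and b odd,
  -- these are the cases of odd and even a.
  six⁺ : Scheme 6 (- + 5) (- + 5)
  six⁺ = tabulated 6 sixTiles 5 5

  six⁻ : Scheme 6 (- + 2) (- + 5)
  six⁻ = tabulated 6 sixTiles 2 5

  -- Positions on a cycle of length 9 + 6 l: the first nine are numbered 0, …, 8 and the others run
  -- through 9, …, 14 periodically.
  advance : Fin 15 → Fin 15
  advance = Vec.lookup (Vec.tail (Vec.allFin 15) Vec.∷ʳ # 9)

  walk : ℕ → Fin 15
  walk zero    = 0F
  walk (suc i) = advance (walk i)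

  -- A cycle can end at position 8, if it has length 9, or at 14, and then closes up at 0.
  successors : Fin 15 → List (Fin 15)
  successors i = advance i ∷ (if does (i Fin.≟ # 8) ∨ does (i Fin.≟ # 14) then 0F ∷ [] else [])

  walk-last : ∀ l → 0F ∈ successors (walk (8 ℕ.+ 6 ℕ.* l))
  walk-last zero = there (here refl)
  walk-last (suc l) = subst (λ i → 0F ∈ successors (walk i)) (sym (cong (8 ℕ.+_) (ℕ.*-suc 6 l)))
      (subst (λ i → 0F ∈ successors i) (sym (walk-14 l)) (there (here refl)))
    where
    walk-14 : ∀ l → walk (14 ℕ.+ 6 ℕ.* l) ≡ # 14
    walk-14 zero    = refl
    walk-14 (suc l) = trans (cong (λ i → walk (14 ℕ.+ i)) (ℕ.*-suc 6 l))
        (cong (λ i → advance (advance (advance (advance (advance (advance i)))))) (walk-14 l))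

  module _ (l : ℕ) where

    private
      n : ℕ
      n = 9 ℕ.+ 6 ℕ.* l

    place : ℤ → Fin 15
    place z = walk (z %ℕ n)

    place-next : ∀ z → place z ∈ successors (place (z - + 1))
    place-next z with suc ((z - + 1) %ℕ n) ℕ.<? n
    ... | yes i<n = subst (λ i → walk i ∈ successors (place (z - + 1))) (sym (residue-unique n {z} i<n
            (shift-∣ (trans (cancel z (+ i)) (cong (λ m → z - m) (sym (ℤ.pos-+ 1 i))))
                (residue-∣ n (z - + 1))))) (here refl)
      where
      i = (z - + 1) %ℕ n
      cancel : ∀ z i → (z - + 1) - i ≡ z - (+ 1 + i)
      cancel = solve-∀
    ... | no i≮n = subst₂ (λ i j → walk i ∈ successors (walk j)) (sym z%n) (sym i≡) (walk-last l)
      where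
      i = (z - + 1) %ℕ n
      i≡ : i ≡ 8 ℕ.+ 6 ℕ.* l
      i≡ = ℕ.suc-injective (ℕ.≤-antisym (n%ℕd<d (z - + 1) n) (ℕ.≮⇒≥ i≮n))
      z%n : z %ℕ n ≡ 0
      z%n = residue-unique n {z} (ℕ.s≤s ℕ.z≤n)
          (shift-∣
          (trans (cong (λ j → (z - + 1) - + j + + n) i≡)
              (trans (cong (λ m → (z - + 1) - + (8 ℕ.+ 6 ℕ.* l) + m) (ℤ.pos-+ 1 (8 ℕ.+ 6 ℕ.* l)))
                  (cancel z (+ (8 ℕ.+ 6 ℕ.* l)))))
        (∣m∣n⇒∣m+n (residue-∣ n (z - + 1)) ∣-refl))
        where
        cancel : ∀ z i → ((z - + 1) - i) + (+ 1 + i) ≡ z - + 0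
        cancel = solve-∀

  -- Both tables were found by computer search.
  doubled squared : Fin 15 → Tile
  doubled = Vec.lookup (tile 4F 0F 2F ∷ tile 3F 1F 4F ∷ tile 0F 3F 2F ∷ tile 4F 0F 1F ∷ tile 3F 4F 2F ∷
    tile 1F 3F 0F ∷ tile 4F 1F 2F ∷ tile 3F 4F 0F ∷ tile 2F 1F 3F ∷ tile 0F 4F 2F ∷
    tile 1F 3F 0F ∷ tile 2F 1F 4F ∷ tile 0F 2F 3F ∷ tile 1F 4F 0F ∷ tile 2F 3F 1F ∷ [])
  squared = Vec.lookup (tile 4F 3F 2F ∷ tile 1F 3F 0F ∷ tile 2F 4F 1F ∷ tile 4F 0F 2F ∷ tile 3F 0F 1F ∷
    tile 2F 4F 3F ∷ tile 4F 1F 2F ∷ tile 0F 1F 3F ∷ tile 2F 4F 0F ∷ tile 4F 2F 3F ∷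
    tile 0F 2F 1F ∷ tile 3F 4F 0F ∷ tile 4F 1F 3F ∷ tile 0F 1F 2F ∷ tile 3F 4F 0F ∷ [])

  -- All transitions that can occur for some length are among the successors, so one finite check
  -- settles every `l`.
  doubled-proper : All (λ i → All (λ j → Proper (doubled j) (doubled i) (doubled i)) (successors i))
      (allFin 15)
  doubled-proper = from-yes (All.all? (λ i → All.all? (λ j →
    proper? (doubled j) (doubled i) (doubled i)) (successors i)) (allFin 15))

  squared-proper : All (λ i → All (λ j → All (λ k → Proper (squared k) (squared i) (squared j))
    (successors j)) (successors i)) (allFin 15)
  squared-proper = from-yes (All.all? (λ i → All.all? (λ j → All.all? (λ k →
    proper? (squared k) (squared i) (squared j)) (successors j)) (successors i)) (allFin 15))

  -- A cycle with every edge doubled: the quotient by the cosets of a - b, where both steps become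
  -- equal.
  doubledScheme : ∀ l → Scheme (9 ℕ.+ 6 ℕ.* l) (+ 1) (+ 1)
  doubledScheme l = record
    { color    = λ z → doubled (place l z)
    ; periodic = λ {x} {y} d → cong (λ i → doubled (walk i)) (residue-cong (9 ℕ.+ 6 ℕ.* l) {x} {y} d)
    ; proper   = λ z → All.lookup (All.lookup doubled-proper (∈-allFin (place l (z - + 1))))
        (place-next l z)
    }

  squaredScheme : ∀ l → Scheme (9 ℕ.+ 6 ℕ.* l) (+ 2) (+ 1)
  squaredScheme l = record
    { color    = λ z → squared (place l z)
    ; periodic = λ {x} {y} d → cong (λ i → squared (walk i)) (residue-cong (9 ℕ.+ 6 ℕ.* l) {x} {y} d)
    ; proper   = λ z → All.lookup (All.lookup (All.lookup squared-proper (∈-allFin (place l (z - + 2))))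
        (subst (λ y → place l (z - + 1) ∈ successors (place l y)) (twice z) (place-next l (z - + 1))))
            (place-next l z)
    }
    where
    twice : ∀ z → (z - + 1) - + 1 ≡ z - + 2
    twice = solve-∀

  module _ {P : Bool → Set} where
    ∀? : (∀ b → Dec (P b)) → Dec (∀ b → P b)
    ∀? P? = map′ (λ { (t , f) true → t ; (t , f) false → f }) (λ all → all true , all false)
        (P? true ×-dec P? false)

  -- Colourings in three layers

  level : Bool → Fin 5
  level true  = 3F
  level false = 4F

  data Sign : Set where
    plus minus : Sign

  sign : Sign → ℤ
  sign plus  = + 1
  sign minus = -1ℤ

  rail : Bool → Bool → Fin 5
  rail defect p = if defect then 0F else level p

  -- On layer 0, d marks the defects and w the ends of Kempe chains; further on, d marks the chain
  -- passing by. The cycles run along a on layer 0 for plus, on layer 1 for minus, and along b on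
  -- the other layers.
  tile₀ : Sign → Bool → Bool → Bool → Tile
  tile₀ plus  d p w = tile (if d then 4F else if w then 3F else 0F) (rail d p) 2F
  tile₀ minus d p w = tile (if d then 4F else if w then 3F else 0F) 2F (rail d p)

  tile₁ : Sign → Bool → Bool → Tile
  tile₁ plus  d p = tile 1F (if d then 3F else 0F) (level (not p))
  tile₁ minus d p = tile 1F (level (not p)) (if d then 3F else 0F)

  tile₂ : Bool → Bool → Tile
  tile₂ d p = tile 2F 1F (rail d p)

  -- `p` and `q` tell whether the cycle edges leaving and entering the vertex have colour 3 before
  -- the exchange. They are not both 4. At the end of a chain the entering edge passes from 3 to 0
  -- and the leaving one has colour 4, which frees 3 for the vertex.
  star₀ : ∀ s p q w d′ p′ → (p ≡ false → q ≡ true) → (w ≡ true → q ≡ true × p ≡ false) →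
    Proper (tile₀ s (p ∧ q) p w) (tile₂ d′ p′) (tile₂ w q)
  star₀ plus = from-yes (∀? λ p → ∀? λ q → ∀? λ w → ∀? λ d′ → ∀? λ p′ →
    (p Bool.≟ false →-dec q Bool.≟ true) →-dec
        (w Bool.≟ true →-dec (q Bool.≟ true ×-dec p Bool.≟ false)) →-dec
    proper? (tile₀ plus (p ∧ q) p w) (tile₂ d′ p′) (tile₂ w q))
  star₀ minus = from-yes (∀? λ p → ∀? λ q → ∀? λ w → ∀? λ d′ → ∀? λ p′ →
    (p Bool.≟ false →-dec q Bool.≟ true) →-dec
        (w Bool.≟ true →-dec (q Bool.≟ true ×-dec p Bool.≟ false)) →-dec
    proper? (tile₀ minus (p ∧ q) p w) (tile₂ d′ p′) (tile₂ w q))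

  -- Where a chain passes, the cycle edge from layer 0 and the remaining edge to layer 2 exchange 3
  -- and 0; this requires the former to have had colour 3.
  star₁⁺ : ∀ d p w d′ p′ w′ → (d ≡ true → p ≡ true) →
    Proper (tile₁ plus d p) (tile₀ plus d p w) (tile₀ plus d′ p′ w′)
  star₁⁺ = from-yes (∀? λ d → ∀? λ p → ∀? λ w → ∀? λ d′ → ∀? λ p′ → ∀? λ w′ →
    (d Bool.≟ true →-dec p Bool.≟ true) →-dec
    proper? (tile₁ plus d p) (tile₀ plus d p w) (tile₀ plus d′ p′ w′))

  star₁⁻ : ∀ d p w d′ p′ w′ → (d ≡ true → p ≡ true) →
    Proper (tile₁ minus d p) (tile₀ minus d′ p′ w′) (tile₀ minus d p w)
  star₁⁻ = from-yes (∀? λ d → ∀? λ p → ∀? λ w → ∀? λ d′ → ∀? λ p′ → ∀? λ w′ →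
    (d Bool.≟ true →-dec p Bool.≟ true) →-dec
    proper? (tile₁ minus d p) (tile₀ minus d′ p′ w′) (tile₀ minus d p w))

  -- The chain now leaves along the cycle edge, which must have had colour 3 to exchange with the
  -- remaining edge of colour 0.
  star₂⁺ : ∀ d p d′ p′ → (d ≡ true → p ≡ true) → Proper (tile₂ d p) (tile₁ plus d p′) (tile₁ plus d′ p)
  star₂⁺ = from-yes (∀? λ d → ∀? λ p → ∀? λ d′ → ∀? λ p′ → (d Bool.≟ true →-dec p Bool.≟ true) →-dec
    proper? (tile₂ d p) (tile₁ plus d p′) (tile₁ plus d′ p))

  star₂⁻ : ∀ d p d′ p′ → (d ≡ true → p ≡ true) → Proper (tile₂ d p) (tile₁ minus d′ p) (tile₁ minus d p′)
  star₂⁻ = from-yes (∀? λ d → ∀? λ p → ∀? λ d′ → ∀? λ p′ → (d Bool.≟ true →-dec p Bool.≟ true) →-dec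
    proper? (tile₂ d p) (tile₁ minus d′ p) (tile₁ minus d p′))

  -- Layer 0 consists of positions modulo M, and r is the displacement in one round along a cycle.
  -- The cycle edge leaving position x has colour 3 if high x is true, and 4 otherwise, before the
  -- exchange along Kempe chains. A defect is a position x with high x and high (x - r); turn makes
  -- the edge next to the end of its chain have colour 3 and the end x + sign s + r not a defect.
  record Pattern (M : ℕ) (r : ℤ) (s : Sign) : Set where
    field
      high     : ℤ → Bool
      high-cong : ∀ x y → + M ∣ x - y → high x ≡ high y
      low⇒high : ∀ x → high x ≡ false → high (x - r) ≡ true
      turn     : ∀ x → high x ≡ true → high (x - r) ≡ true →
                 high (x + sign s) ≡ true × high (x + sign s + r) ≡ false

  ∧-true : ∀ x {y} → x ∧ y ≡ true → x ≡ true × y ≡ true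
  ∧-true true e = refl , e

  minus-cong : ∀ {m} x y k → m ∣ x - y → m ∣ (x - k) - (y - k)
  minus-cong x y k = shift-∣ (cancel x y k)
    where
    cancel : ∀ x y k → x - y ≡ (x - k) - (y - k)
    cancel = solve-∀

  module Layers (M : ℕ) (c : ℤ) (s : Sign) (P : Pattern M (c + + 1) s) where
    open Pattern P

    defect : ℤ → Bool
    defect x = high x ∧ high (x - c - + 1)

    defect-cong : ∀ x y → + M ∣ x - y → defect x ≡ defect y
    defect-cong x y d = cong₂ _∧_ (high-cong x y d)
        (high-cong _ _ (minus-cong (x - c) (y - c) (+ 1) (minus-cong x y c d)))

    high-r : ∀ x → high (x - (c + + 1)) ≡ high (x - c - + 1)
    high-r x = cong high (assoc x c)
      where
      assoc : ∀ x c → x - (c + + 1) ≡ x - c - + 1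
      assoc = solve-∀

    defect⇒high : ∀ x → defect x ≡ true → high (x + sign s) ≡ true × high (x + sign s + (c + + 1)) ≡ false
    defect⇒high x d = let p , q = ∧-true (high x) d in turn x p (trans (high-r x) q)

  -- The shifts undo the motion from layer 0. On layers 1, 2 and 0 a chain from position x meets x +
  -- 1, x + 2 and x + c + 2 for `plus`, but x, x and x + c for `minus`. The cycle from x meets x + 1
  -- and x + 1 on layers 1 and 2 for `plus`, x and x + 1 for `minus`, and in both cases returns at x
  -- + c + 1.
  layer : ∀ {M} c s → Pattern M (c + + 1) s → ℕ → ℤ → Tile
  layer {M} c plus P = layer⁺
    where
    open Layers M c plus P
    open Pattern P
    layer⁺ : ℕ → ℤ → Tile
    layer⁺ 0 x = tile₀ plus (defect x) (high x) (defect (x - c - + 1 - + 1))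
    layer⁺ 1 x = tile₁ plus (defect (x - + 1)) (high (x - + 1))
    layer⁺ _ x = tile₂ (defect (x - + 1 - + 1)) (high (x - + 1))
  layer {M} c minus P = layer⁻
    where
    open Layers M c minus P
    open Pattern P
    layer⁻ : ℕ → ℤ → Tile
    layer⁻ 0 x = tile₀ minus (defect x) (high x) (defect (x - c))
    layer⁻ 1 x = tile₁ minus (defect x) (high x)
    layer⁻ _ x = tile₂ (defect x) (high (x - + 1))

  tile₀-cong : ∀ s {d d′ p p′ w w′} → d ≡ d′ → p ≡ p′ → w ≡ w′ → tile₀ s d p w ≡ tile₀ s d′ p′ w′
  tile₀-cong s refl refl refl = refl

  layer-cong : ∀ {M} c s (P : Pattern M (c + + 1) s) i x y → + M ∣ x - y →
      layer c s P i x ≡ layer c s P i y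
  layer-cong {M} c plus P i x y d = go i
    where
    open Layers M c plus P
    open Pattern P
    e₁ = minus-cong x y (+ 1) d
    go : ∀ i → layer c plus P i x ≡ layer c plus P i y
    go 0 = tile₀-cong plus (defect-cong x y d) (high-cong x y d)
      (defect-cong _ _
          (minus-cong (x - c - + 1) (y - c - + 1) (+ 1)
          (minus-cong (x - c) (y - c) (+ 1) (minus-cong x y c d))))
    go 1 = cong₂ (tile₁ plus) (defect-cong _ _ e₁) (high-cong _ _ e₁)
    go (suc (suc _)) = cong₂ tile₂ (defect-cong _ _ (minus-cong (x - + 1) (y - + 1) (+ 1) e₁))
        (high-cong _ _ e₁)
  layer-cong {M} c minus P i x y d = go i
    where
    open Layers M c minus P
    open Pattern P
    go : ∀ i → layer c minus P i x ≡ layer c minus P i y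
    go 0 = tile₀-cong minus (defect-cong x y d) (high-cong x y d) (defect-cong _ _ (minus-cong x y c d))
    go 1 = cong₂ (tile₁ minus) (defect-cong x y d) (high-cong x y d)
    go (suc (suc _)) = cong₂ tile₂ (defect-cong x y d) (high-cong _ _ (minus-cong x y (+ 1) d))

  layer₀-proper : ∀ {M} c s (P : Pattern M (c + + 1) s) x →
    Proper (layer c s P 0 x) (layer c s P 2 (x - c - + 1)) (layer c s P 2 (x - c))
  layer₀-proper {M} c plus P x = star₀ plus (high x) (high (x - c - + 1)) _
      (defect (x - c - + 1 - + 1 - + 1)) (high (x - c - + 1 - + 1))
      (λ e → trans (sym (high-r x)) (low⇒high x e))
      (λ e → let p , q = defect⇒high _ e in trans (cong high (back x c)) p , trans (cong high (forth x c)) q)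
    where
    open Layers M c plus P
    open Pattern P
    back : ∀ x c → x - c - + 1 ≡ x - c - + 1 - + 1 + + 1
    back = solve-∀
    forth : ∀ x c → x ≡ x - c - + 1 - + 1 + + 1 + (c + + 1)
    forth = solve-∀
  layer₀-proper {M} c minus P x = star₀ minus (high x) (high (x - c - + 1)) _ (defect (x - c - + 1))
      (high (x - c - + 1 - + 1))
      (λ e → trans (sym (high-r x)) (low⇒high x e))
      (λ e → let p , q = defect⇒high _ e in p , trans (cong high (forth x c)) q)
    where
    open Layers M c minus P
    open Pattern P
    forth : ∀ x c → x ≡ x - c - + 1 + (c + + 1)
    forth = solve-∀

  layer₁-proper : ∀ {M} c s (P : Pattern M (c + + 1) s) x →
    Proper (layer c s P 1 x) (layer c s P 0 (x - + 1)) (layer c s P 0 x)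
  layer₁-proper {M} c plus P x =
    star₁⁺ (defect (x - + 1)) (high (x - + 1)) (defect (x - + 1 - c - + 1 - + 1)) (defect x) (high x)
        (defect (x - c - + 1 - + 1))
      (λ e → ∧-true (high (x - + 1)) e .proj₁)
    where
    open Layers M c plus P
    open Pattern P
  layer₁-proper {M} c minus P x =
    star₁⁻ (defect x) (high x) (defect (x - c)) (defect (x - + 1)) (high (x - + 1)) (defect (x - + 1 - c))
      (λ e → ∧-true (high x) e .proj₁)
    where
    open Layers M c minus P
    open Pattern P

  layer₂-proper : ∀ {M} c s (P : Pattern M (c + + 1) s) x →
    Proper (layer c s P 2 x) (layer c s P 1 (x - + 1)) (layer c s P 1 x)
  layer₂-proper {M} c plus P x = star₂⁺ (defect (x - + 1 - + 1)) (high (x - + 1)) (defect (x - + 1))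
      (high (x - + 1 - + 1))
      (λ e → trans (cong high (back x)) (defect⇒high _ e .proj₁))
    where
    open Layers M c plus P
    open Pattern P
    back : ∀ x → x - + 1 ≡ x - + 1 - + 1 + + 1
    back = solve-∀
  layer₂-proper {M} c minus P x = star₂⁻ (defect x) (high (x - + 1)) (defect (x - + 1)) (high x)
      (λ e → defect⇒high x e .proj₁)
    where
    open Layers M c minus P
    open Pattern P

  -- The layers as a scheme on the integers.

  divMod-unique : ∀ m .{{_ : ℕ.NonZero m}} {z i q} → i ℕ.< m → z ≡ + i + q * + m → z %ℕ m ≡ i × z /ℕ m ≡ q
  divMod-unique m {z} {i} {q} i<m refl = rem , ℤ.*-cancelʳ-≡ _ _ (+ m) (∙-cancelˡ (+ i) _ _
      (trans (cong (λ r → + r + z /ℕ m * + m) (sym rem)) (sym (a≡a%ℕn+[a/ℕn]*n z m))))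
    where
    rem : z %ℕ m ≡ i
    rem = residue-unique m {z} i<m (divides q (cancel (+ i) (q * + m)))
      where
      cancel : ∀ i q → (i + q) - i ≡ q
      cancel = solve-∀

  module _ (M : ℕ) (w u β : ℤ) (wu≡1 : + M ∣ w * u - + 1) where

    private
      b : ℤ
      b = + 1 + β * + 3

      c : ℤ
      c = w * b

    module _ {s : Sign} (P : Pattern M (c + + 1) s) where

      -- The vertex i + 3 q lies on layer i at position w (q - i β): b preserves positions and a
      -- increases them by one, except that c is added in passing from layer 2 to layer 0.
      layerOf : ℤ → Tile
      layerOf z = layer c s P (z %ℕ 3) (w * (z /ℕ 3 - + (z %ℕ 3) * β))

      layerOf-≡ : ∀ {z} i q x → i ℕ.< 3 → z ≡ + i + q * + 3 → + M ∣ w * (q - + i * β) - x →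
          layerOf z ≡ layer c s P i x
      layerOf-≡ {z} i q x i<3 e d = let r≡ , q≡ = divMod-unique 3 {q = q} i<3 e in
        trans (cong₂ (λ r q → layer c s P r (w * (q - + r * β))) r≡ q≡) (layer-cong c s P i _ x d)

      split : ∀ z → z ≡ + (z %ℕ 3) + z /ℕ 3 * + 3
      split z = a≡a%ℕn+[a/ℕn]*n z 3

      layerOf-proper : ∀ z → Proper (layerOf z) (layerOf (z - (b + u * + 3))) (layerOf (z - b))
      layerOf-proper z with z %ℕ 3 | z /ℕ 3 | split z | n%ℕd<d z 3
      -- Going back from layer 0 to layer 2 borrows one from the quotient. With one β from the step
      -- and two from the change of layer, the position drops by w (1 + 3 β) = c; the step a
      -- contributes a further w u ≡ 1.
      ... | 0 | q | e | _ = subst₂ (Proper _) (sym a-pred) (sym b-pred) (layer₀-proper c s P _)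
        where
        a-pred : layerOf (z - (b + u * + 3)) ≡ layer c s P 2 (w * (q - + 0 * β) - c - + 1)
        a-pred = layerOf-≡ 2 (q - β - u - + 1) _ (ℕ.s≤s (ℕ.s≤s (ℕ.s≤s ℕ.z≤n)))
            (trans (cong (λ z → z - (b + u * + 3)) e) (quotient-≡ q β u))
            (shift-∣ (position w q β u) (∣m⇒∣-m wu≡1))
          where
          quotient-≡ : ∀ q β u →
              (+ 0 + q * + 3) - ((+ 1 + β * + 3) + u * + 3) ≡ + 2 + (q - β - u - + 1) * + 3
          quotient-≡ = solve-∀
          position : ∀ w q β u →
              - (w * u - + 1) ≡ w * ((q - β - u - + 1) - + 2 * β)
              - (w * (q - + 0 * β) - w * (+ 1 + β * + 3) - + 1)
          position = solve-∀
        b-pred : layerOf (z - b) ≡ layer c s P 2 (w * (q - + 0 * β) - c)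
        b-pred = layerOf-≡ 2 (q - β - + 1) _ (ℕ.s≤s (ℕ.s≤s (ℕ.s≤s ℕ.z≤n)))
            (trans (cong (λ z → z - b) e) (quotient-≡ q β)) (divides 0ℤ (position w q β))
          where
          quotient-≡ : ∀ q β → (+ 0 + q * + 3) - (+ 1 + β * + 3) ≡ + 2 + (q - β - + 1) * + 3
          quotient-≡ = solve-∀
          position : ∀ w q β →
              w * ((q - β - + 1) - + 2 * β) - (w * (q - + 0 * β) - w * (+ 1 + β * + 3)) ≡ 0ℤ
          position = solve-∀
      ... | 1 | q | e | _ = subst₂ (Proper _) (sym a-pred) (sym b-pred) (layer₁-proper c s P _)
        where
        a-pred : layerOf (z - (b + u * + 3)) ≡ layer c s P 0 (w * (q - + 1 * β) - + 1)
        a-pred = layerOf-≡ 0 (q - β - u) _ (ℕ.s≤s ℕ.z≤n)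
            (trans (cong (λ z → z - (b + u * + 3)) e) (quotient-≡ q β u))
            (shift-∣ (position w q β u) (∣m⇒∣-m wu≡1))
          where
          quotient-≡ : ∀ q β u → (+ 1 + q * + 3) - ((+ 1 + β * + 3) + u * + 3) ≡ + 0 + (q - β - u) * + 3
          quotient-≡ = solve-∀
          position : ∀ w q β u → - (w * u - + 1) ≡ w * ((q - β - u) - + 0 * β) - (w * (q - + 1 * β) - + 1)
          position = solve-∀
        b-pred : layerOf (z - b) ≡ layer c s P 0 (w * (q - + 1 * β))
        b-pred = layerOf-≡ 0 (q - β) _ (ℕ.s≤s ℕ.z≤n) (trans (cong (λ z → z - b) e) (quotient-≡ q β))
            (divides 0ℤ (position w q β))
          where
          quotient-≡ : ∀ q β → (+ 1 + q * + 3) - (+ 1 + β * + 3) ≡ + 0 + (q - β) * + 3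
          quotient-≡ = solve-∀
          position : ∀ w q β → w * ((q - β) - + 0 * β) - w * (q - + 1 * β) ≡ 0ℤ
          position = solve-∀
      ... | 2 | q | e | _ = subst₂ (Proper _) (sym a-pred) (sym b-pred) (layer₂-proper c s P _)
        where
        a-pred : layerOf (z - (b + u * + 3)) ≡ layer c s P 1 (w * (q - + 2 * β) - + 1)
        a-pred = layerOf-≡ 1 (q - β - u) _ (ℕ.s≤s (ℕ.s≤s ℕ.z≤n))
            (trans (cong (λ z → z - (b + u * + 3)) e) (quotient-≡ q β u))
            (shift-∣ (position w q β u) (∣m⇒∣-m wu≡1))
          where
          quotient-≡ : ∀ q β u → (+ 2 + q * + 3) - ((+ 1 + β * + 3) + u * + 3) ≡ + 1 + (q - β - u) * + 3
          quotient-≡ = solve-∀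
          position : ∀ w q β u → - (w * u - + 1) ≡ w * ((q - β - u) - + 1 * β) - (w * (q - + 2 * β) - + 1)
          position = solve-∀
        b-pred : layerOf (z - b) ≡ layer c s P 1 (w * (q - + 2 * β))
        b-pred = layerOf-≡ 1 (q - β) _ (ℕ.s≤s (ℕ.s≤s ℕ.z≤n))
            (trans (cong (λ z → z - b) e) (quotient-≡ q β)) (divides 0ℤ (position w q β))
          where
          quotient-≡ : ∀ q β → (+ 2 + q * + 3) - (+ 1 + β * + 3) ≡ + 1 + (q - β) * + 3
          quotient-≡ = solve-∀
          position : ∀ w q β → w * ((q - β) - + 1 * β) - w * (q - + 2 * β) ≡ 0ℤ
          position = solve-∀
      ... | suc (suc (suc _)) | _ | _ | ℕ.s≤s (ℕ.s≤s (ℕ.s≤s ()))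

      layered : Scheme (M ℕ.* 3) (b + u * + 3) b
      layered .color = layerOf
      layered .periodic {x} {y} d@(divides k e) = layerOf-≡ (y %ℕ 3) (k * + M + y /ℕ 3) _ (n%ℕd<d y 3)
        (trans (restore x y) (trans (cong₂ _+_ (trans e (cong (k *_) (ℤ.pos-* M 3))) (split y))
            (regroup k (+ M) (+ (y %ℕ 3)) (y /ℕ 3))))
        (divides (w * k) (position w k (+ M) (y /ℕ 3) (+ (y %ℕ 3) * β)))
        where
        restore : ∀ x y → x ≡ (x - y) + y
        restore = solve-∀
        regroup : ∀ k M r q → k * (M * + 3) + (r + q * + 3) ≡ r + (k * M + q) * + 3
        regroup = solve-∀
        position : ∀ w k M q r → w * (k * M + q - r) - w * (q - r) ≡ (w * k) * M
        position = solve-∀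
      layered .proper = layerOf-proper

  -- Patterns of alternating blocks.

  open Pattern

  even : ℕ → Bool
  even zero    = true
  even (suc n) = not (even n)

  /-unique : ∀ i t ρ .{{_ : ℕ.NonZero ρ}} → i ℕ.* ρ ℕ.≤ t → t ℕ.< suc i ℕ.* ρ → t ℕ./ ρ ≡ i
  /-unique i t ρ lower upper = ℕ.≤-antisym (ℕ.s≤s⁻¹ (ℕ.m<n*o⇒m/o<n upper))
    (subst (ℕ._≤ t ℕ./ ρ) (ℕ.m*n/n≡m i ρ) (ℕ./-monoˡ-≤ ρ lower))

  module Blocks (M ρ : ℕ) .{{_ : ℕ.NonZero M}} .{{_ : ℕ.NonZero ρ}} (2ρ<M : ρ ℕ.+ ρ ℕ.< M)
      (ρ∤M : ¬ ρ ℕ.∣ M) where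

    q f : ℕ
    q = M ℕ./ ρ
    f = M ℕ.% ρ

    f<ρ : f ℕ.< ρ
    f<ρ = ℕ.m%n<n M ρ

    M≡ : M ≡ f ℕ.+ q ℕ.* ρ
    M≡ = ℕ.m≡m%n+[m/n]*n M ρ

    0<f : 0 ℕ.< f
    0<f = ℕ.n≢0⇒n>0 (λ f≡0 → ρ∤M (ℕ.m%n≡0⇒n∣m M ρ f≡0))

    -- The values alternate in blocks of ρ consecutive positions, so that defects occur only where
    -- the sequence closes up: with M = q ρ + f, their number is ρ - f for odd q and f for even q.
    block : ℤ → Bool
    block x = even ((x %ℕ M) ℕ./ ρ)

    block-at : ∀ x j → j ℕ.< M → + M ∣ x - + j → block x ≡ even (j ℕ./ ρ)
    block-at x j j<M d = cong (λ r → even (r ℕ./ ρ)) (residue-unique M {x} j<M d)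

    block-0 : ∀ x k → k ℕ.< ρ → + M ∣ x - + k → block x ≡ true
    block-0 x k k<ρ d = trans (block-at x k (ℕ.<-trans (ℕ.<-≤-trans k<ρ (ℕ.m≤m+n ρ ρ)) 2ρ<M) d)
        (cong even (ℕ.m<n⇒m/n≡0 k<ρ))

    block-1 : ∀ x k → k ℕ.< ρ → + M ∣ x - + (k ℕ.+ ρ) → block x ≡ false
    block-1 x k k<ρ d = trans (block-at x (k ℕ.+ ρ) (ℕ.<-trans k+ρ<2ρ 2ρ<M) d)
      (cong even (/-unique 1 (k ℕ.+ ρ) ρ (subst (ℕ._≤ k ℕ.+ ρ) (sym (ℕ.*-identityˡ ρ)) (ℕ.m≤n+m ρ k))
        (subst (k ℕ.+ ρ ℕ.<_) (cong (ρ ℕ.+_) (sym (ℕ.*-identityˡ ρ))) k+ρ<2ρ)))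
      where
      k+ρ<2ρ : k ℕ.+ ρ ℕ.< ρ ℕ.+ ρ
      k+ρ<2ρ = ℕ.+-monoˡ-< ρ k<ρ

    -- Either x and x - ρ lie in adjacent blocks, or the point where the sequence closes up
    -- separates them: then x has residue k in block 0 and x - ρ has residue j among the last ρ
    -- positions.
    data Position (x : ℤ) : Set where
      inner   : block x ≡ not (block (x - + ρ)) → Position x
      wrapped : ∀ j k → j ℕ.< M → k ℕ.+ M ≡ j ℕ.+ ρ → + M ∣ x - + k → block (x - + ρ) ≡ even
          (j ℕ./ ρ) → Position x

    locate : ∀ x → Position x
    locate x with (x - + ρ) %ℕ M in eq | residue-∣ M (x - + ρ) | n%ℕd<d (x - + ρ) M
    ... | j | d | j<M with j ℕ.+ ρ ℕ.<? M
    ... | yes j+ρ<M =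
        inner
        (trans
            (block-at x (j ℕ.+ ρ) j+ρ<M
                (shift-∣ (trans (cancel x (+ ρ) (+ j)) (cong (λ y → x - y) (sym (ℤ.pos-+ j ρ)))) d))
        (trans (cong even (/-step j)) (cong (λ r → not (even (r ℕ./ ρ))) (sym eq))))
      where
      cancel : ∀ x r j → (x - r) - j ≡ x - (j + r)
      cancel = solve-∀
      /-step : ∀ j → (j ℕ.+ ρ) ℕ./ ρ ≡ suc (j ℕ./ ρ)
      /-step j = trans (ℕ.+-distrib-/-∣ʳ j ℕ.∣-refl)
          (trans (cong (j ℕ./ ρ ℕ.+_) (ℕ.n/n≡1 ρ)) (ℕ.+-comm _ 1))
    ... | no j+ρ≮M = wrapped j (j ℕ.+ ρ ℕ.∸ M) j<M (ℕ.m∸n+n≡m (ℕ.≮⇒≥ j+ρ≮M))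
        (shift-∣ (trans (cong (λ y → (x - + ρ) - + j + y) (sym wrap))
            (cancel x (+ ρ) (+ j) (+ (j ℕ.+ ρ ℕ.∸ M)))) (∣m∣n⇒∣m+n d ∣-refl))
        (cong (λ r → even (r ℕ./ ρ)) eq)
      where
      wrap : + j + + ρ - + (j ℕ.+ ρ ℕ.∸ M) ≡ + M
      wrap =
          trans
          (cong (_- + (j ℕ.+ ρ ℕ.∸ M))
              (trans (sym (ℤ.pos-+ j ρ)) (trans (cong +_ (sym (ℕ.m∸n+n≡m (ℕ.≮⇒≥ j+ρ≮M))))
                  (ℤ.pos-+ (j ℕ.+ ρ ℕ.∸ M) M)))) (drop (+ (j ℕ.+ ρ ℕ.∸ M)) (+ M))
        where
        drop : ∀ k m → (k + m) - k ≡ m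
        drop = solve-∀
      cancel : ∀ x r j k → (x - r) - j + (j + r - k) ≡ x - k
      cancel = solve-∀

    k<ρ : ∀ {j k} → j ℕ.< M → k ℕ.+ M ≡ j ℕ.+ ρ → k ℕ.< ρ
    k<ρ {j} {k} j<M e = ℕ.+-cancelʳ-< M k ρ (subst₂ ℕ._<_ (sym e) (ℕ.+-comm M ρ) (ℕ.+-monoˡ-< ρ j<M))

    -- Adjacent blocks have opposite values, and across the closing point x lies in block 0, which
    -- is high.
    block-low⇒high : ∀ x → block x ≡ false → block (x - + ρ) ≡ true
    block-low⇒high x low with locate x
    ... | inner e = Bool.not-injective (trans (sym e) low)
    ... | wrapped j k j<M e d _ with () ← trans (sym low) (block-0 x k (k<ρ j<M e) d)

    -- For odd q the incomplete block q is low. Hence a high j lies before it, so j < M - f and k <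
    -- ρ - f with f > 0: the next position is still in block 0.
    wrapped-turn⁺ : even q ≡ false → ∀ {j k} → j ℕ.< M → k ℕ.+ M ≡ j ℕ.+ ρ → even (j ℕ./ ρ) ≡ true →
        suc k ℕ.< ρ
    wrapped-turn⁺ odd-q {j} {k} j<M e even-j = ℕ.<-≤-trans (ℕ.m<m+n (suc k) 0<f) k+f<ρ
      where
      j<qρ : j ℕ.< q ℕ.* ρ
      j<qρ = ℕ.≰⇒> λ qρ≤j → contradiction (trans (sym even-j) (trans (cong even (/-unique q j ρ qρ≤j
        (ℕ.<-trans j<M (subst (ℕ._< ρ ℕ.+ q ℕ.* ρ) (sym M≡) (ℕ.+-monoˡ-< (q ℕ.* ρ) f<ρ))))) odd-q)) λ ()
      k+f<ρ : k ℕ.+ f ℕ.< ρ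
      k+f<ρ = ℕ.+-cancelʳ-< (q ℕ.* ρ) (k ℕ.+ f) ρ (subst₂ ℕ._<_
        (trans (sym e) (trans (cong (k ℕ.+_) M≡) (sym (ℕ.+-assoc k f (q ℕ.* ρ))))) (ℕ.+-comm (q ℕ.* ρ) ρ)
            (ℕ.+-monoˡ-< ρ j<qρ))

    -- If k were 0, x - ρ would have residue M - ρ, in the low block q - 1. So the previous position
    -- is also in block 0.
    wrapped-turn⁻ : even q ≡ true → ∀ {j k} → j ℕ.< M → k ℕ.+ M ≡ j ℕ.+ ρ → even (j ℕ./ ρ) ≡ true →
        0 ℕ.< k
    wrapped-turn⁻ even-q {j} {zero} j<M e even-j = contradiction
        (trans (sym even-j) (odd-j q even-q refl)) λ ()
      where
      -- Here j = M - ρ lies in block q - 1.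
      odd-j : ∀ t → even t ≡ true → q ≡ t → even (j ℕ./ ρ) ≡ false
      odd-j zero _ q≡0 = contradiction
          (ℕ.<-trans (ℕ.≤-<-trans (ℕ.m≤m+n ρ ρ) 2ρ<M)
          (subst (ℕ._< ρ)
              (sym (trans M≡ (trans (cong (λ t → f ℕ.+ t ℕ.* ρ) q≡0) (ℕ.+-identityʳ f)))) f<ρ))
                  (ℕ.<-irrefl refl)
      odd-j (suc t) even-t q≡ =
          trans (cong even (/-unique t j ρ (subst (t ℕ.* ρ ℕ.≤_) (sym j≡) (ℕ.m≤n+m (t ℕ.* ρ) f))
          (subst (ℕ._< ρ ℕ.+ t ℕ.* ρ) (sym j≡) (ℕ.+-monoˡ-< (t ℕ.* ρ) f<ρ)))) (Bool.not-injective even-t)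
        where
        j≡ : j ≡ f ℕ.+ t ℕ.* ρ
        j≡ = ℕ.+-cancelʳ-≡ ρ j (f ℕ.+ t ℕ.* ρ)
            (trans (sym e) (trans M≡ (trans (cong (λ t → f ℕ.+ t ℕ.* ρ) q≡)
          (trans (cong (f ℕ.+_) (ℕ.+-comm ρ (t ℕ.* ρ))) (sym (ℕ.+-assoc f (t ℕ.* ρ) ρ))))))
    wrapped-turn⁻ even-q {j} {suc k} j<M e even-j = ℕ.s≤s ℕ.z≤n

    block-cong : ∀ x y → + M ∣ x - y → block x ≡ block y
    block-cong x y d = cong (λ r → even (r ℕ./ ρ)) (residue-cong M {x} {y} d)

    -- Every defect x is at the closing point. Moving one step, forwards for odd q and backwards for
    -- even q, stays in the high block 0, and adding ρ then leads to the low block 1, which is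
    -- complete as 2 ρ < M.
    blockPattern : ∃ (Pattern M (+ ρ))
    blockPattern with even q in even-q
    ... | false = plus , record { high = block ; high-cong = block-cong ; low⇒high =
        block-low⇒high ; turn = turn⁺ }
      where
      turn⁺ : ∀ x → block x ≡ true → block (x - + ρ) ≡ true → block (x + + 1) ≡ true × block
          (x + + 1 + + ρ) ≡ false
      turn⁺ x p q with locate x
      ... | inner e = contradiction (trans (sym p) (trans e (cong not q))) λ ()
      ... | wrapped j k j<M e d e′ = block-0 (x + + 1) (suc k) k+1<ρ
          (shift-∣ (trans (one x (+ k)) (cong (λ y → x + + 1 - y) (sym (ℤ.pos-+ 1 k)))) d)
        , block-1 (x + + 1 + + ρ) (suc k) k+1<ρ
            (shift-∣
            (trans (two x (+ k) (+ ρ))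
                (cong (λ y → x + + 1 + + ρ - y)
                    (sym (trans (ℤ.pos-+ (suc k) ρ) (cong (_+ + ρ) (ℤ.pos-+ 1 k)))))) d)
        where
        k+1<ρ = wrapped-turn⁺ even-q j<M e (trans (sym e′) q)
        one : ∀ x k → x - k ≡ x + + 1 - (+ 1 + k)
        one = solve-∀
        two : ∀ x k r → x - k ≡ x + + 1 + r - (+ 1 + k + r)
        two = solve-∀
    ... | true = minus , record { high = block ; high-cong = block-cong ; low⇒high =
        block-low⇒high ; turn = turn⁻ }
      where
      turn⁻ : ∀ x → block x ≡ true → block (x - + ρ) ≡ true → block (x + -1ℤ) ≡ true × block
          (x + -1ℤ + + ρ) ≡ false
      turn⁻ x p q with locate x
      ... | inner e = contradiction (trans (sym p) (trans e (cong not q))) λ ()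
      ... | wrapped j zero j<M e d e′ = contradiction (wrapped-turn⁻ even-q j<M e (trans (sym e′) q))
          (ℕ.<-irrefl refl)
      ... | wrapped j (suc k) j<M e d e′ = block-0 (x + -1ℤ) k k′<ρ
          (shift-∣ (trans (cong (λ y → x - y) (ℤ.pos-+ 1 k)) (one x (+ k))) d)
        , block-1 (x + -1ℤ + + ρ) k k′<ρ
            (shift-∣
            (trans (cong (λ y → x - y) (ℤ.pos-+ 1 k))
                (trans (two x (+ k) (+ ρ)) (cong (λ y → x + -1ℤ + + ρ - y) (sym (ℤ.pos-+ k ρ))))) d)
        where
        k′<ρ : k ℕ.< ρ
        k′<ρ = ℕ.<-trans (ℕ.n<1+n k) (k<ρ j<M e)
        one : ∀ x k → x - (+ 1 + k) ≡ x + -1ℤ - k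
        one = solve-∀
        two : ∀ x k r → x - (+ 1 + k) ≡ x + -1ℤ + r - (k + r)
        two = solve-∀

  -- Symmetries of patterns.

  flip : Sign → Sign
  flip plus  = minus
  flip minus = plus

  sign-flip : ∀ s → sign (flip s) ≡ - sign s
  sign-flip plus  = refl
  sign-flip minus = refl

  -- Reversing the order of the positions negates the displacement and the direction of `turn`.
  reflect : ∀ {M r s} → Pattern M r s → Pattern M (- r) (flip s)
  reflect {M} {r} {s} P = record
    { high = λ x → P .high (- x)
    ; high-cong = λ x y d → P .high-cong (- x) (- y) (shift-∣ (neg-minus x y) (∣m⇒∣-m d))
    ; low⇒high = λ x e → trans (cong (P .high) (sub x r)) (P .low⇒high (- x) e)
    ; turn = λ x p q → let p′ , q′ = P .turn (- x) p (trans (cong (P .high) (sym (sub x r))) q) in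
        trans (cong (λ t → P .high (- (x + t))) (sign-flip s))
            (trans (cong (P .high) (add x (sign s))) p′) ,
        trans (cong (λ t → P .high (- (x + t + - r))) (sign-flip s))
            (trans (cong (P .high) (add₂ x (sign s) r)) q′)
    }
    where
    neg-minus : ∀ x y → - (x - y) ≡ - x - - y
    neg-minus = solve-∀
    sub : ∀ x r → - (x - - r) ≡ - x - r
    sub = solve-∀
    add : ∀ x t → - (x + - t) ≡ - x + t
    add = solve-∀
    add₂ : ∀ x t r → - (x + - t + - r) ≡ - x + t + r
    add₂ = solve-∀

  pattern-cong : ∀ {M r r′ s} → + M ∣ r - r′ → Pattern M r s → Pattern M r′ s
  pattern-cong {M} {r} {r′} {s} d P = record
    { high = P .high
    ; high-cong = P .high-cong
    ; low⇒high = λ x e → trans (P .high-cong _ _ (shift-∣ (sub x r r′) d)) (P .low⇒high x e)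
    ; turn = λ x p q → let p′ , q′ = P .turn x p (trans (sym (P .high-cong _ _ (shift-∣ (sub x r r′) d))) q) in
        p′ , trans (sym (P .high-cong _ _ (shift-∣ (add (x + sign s) r r′) d))) q′
    }
    where
    sub : ∀ x r r′ → r - r′ ≡ (x - r′) - (x - r)
    sub = solve-∀
    add : ∀ x r r′ → r - r′ ≡ (x + r) - (x + r′)
    add = solve-∀

  -- Reduction to the constructions

  -- ρ is the distance from t to the nearest multiple of M; a tie is impossible for odd M.
  halve : ∀ {M} t → ¬ 2 ℕ.∣ M → 0 ℕ.< t → t ℕ.< M → ∃ λ ρ → 0 ℕ.< ρ × ρ ℕ.+ ρ ℕ.< M ×
      (t ≡ ρ ⊎ t ℕ.+ ρ ≡ M)
  halve {M} t odd 0<t t<M with ℕ.<-cmp (t ℕ.+ t) M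
  ... | tri< 2t<M _ _ = t , 0<t , 2t<M , inj₁ refl
  ... | tri≈ _ 2t≡M _ = contradiction
      (ℕ.divides t (trans (sym 2t≡M) (trans (cong (t ℕ.+_) (sym (ℕ.+-identityʳ t))) (ℕ.*-comm 2 t)))) odd
  ... | tri> _ _ 2t>M = M ℕ.∸ t , ℕ.m<n⇒0<n∸m t<M , 2ρ<M , inj₂ (ℕ.m+[n∸m]≡n (ℕ.<⇒≤ t<M))
    where
    2ρ<M : (M ℕ.∸ t) ℕ.+ (M ℕ.∸ t) ℕ.< M
    2ρ<M = ℕ.<-≤-trans
        (ℕ.+-monoʳ-< (M ℕ.∸ t)
        (ℕ.+-cancelʳ-< t (M ℕ.∸ t) t (subst (ℕ._< t ℕ.+ t) (sym (ℕ.m∸n+n≡m (ℕ.<⇒≤ t<M))) 2t>M)))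
      (ℕ.≤-reflexive (ℕ.m∸n+n≡m (ℕ.<⇒≤ t<M)))

  residue-pattern : ∀ {M} .{{_ : ℕ.NonZero M}} {r t ρ} → 0 ℕ.< ρ → ρ ℕ.+ ρ ℕ.< M → t ≡ ρ ⊎ t ℕ.+ ρ ≡ M →
      ¬ ρ ℕ.∣ M →
    + M ∣ r - + t → ∃ (Pattern M r)
  residue-pattern {M} {r} {t} {ρ@(suc _)} _ 2ρ<M t≡ ρ∤M d with Blocks.blockPattern M ρ 2ρ<M ρ∤M | t≡
  ... | s , P | inj₁ refl = s , pattern-cong (shift-∣ (neg-minus r (+ ρ)) (∣m⇒∣-m d)) P
    where
    neg-minus : ∀ r t → - (r - t) ≡ t - r
    neg-minus = solve-∀
  ... | s , P | inj₂ t+ρ≡M = flip s , pattern-cong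
      (shift-∣ (trans (cong (λ m → - (r - + t) - m) (trans (cong +_ (sym t+ρ≡M)) (ℤ.pos-+ t ρ)))
      (cancel r (+ t) (+ ρ))) (∣m∣n⇒∣m-n (∣m⇒∣-m d) ∣-refl)) (reflect P)
    where
    cancel : ∀ r t ρ → - (r - t) - (t + ρ) ≡ - ρ - r
    cancel = solve-∀

  parity : ∀ n → 2 ℕ.∣ n ⊎ 2 ℕ.∣ suc n
  parity zero = inj₁ (2 ℕ.∣0)
  parity (suc n) with parity n
  ... | inj₁ 2∣n = inj₂ (ℕ.∣m∣n⇒∣m+n ℕ.∣-refl 2∣n)
  ... | inj₂ 2∣sn = inj₁ 2∣sn

  -- One of two consecutive numbers is even and cannot divide an odd one.
  consecutive-divisors : ∀ {M} ρ → ¬ 2 ℕ.∣ M → ρ ℕ.∣ M → ¬ suc ρ ℕ.∣ M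
  consecutive-divisors ρ odd d e with parity ρ
  ... | inj₁ 2∣ρ = odd (ℕ.∣-trans 2∣ρ d)
  ... | inj₂ 2∣sρ = odd (ℕ.∣-trans 2∣sρ e)

  -- The two patterns serve (a, b) and, after reflection, (b, a).
  data Turnable (M : ℕ) (c : ℤ) : Set where
    turn₁      : ∃ (Pattern M (c + + 1)) → Turnable M c
    turn₂      : ∃ (Pattern M (c + + 2)) → Turnable M c
    shift₁     : + M ∣ c + + 1 → Turnable M c
    shift₂     : + M ∣ c + + 2 → Turnable M c
    degenerate : M ≡ 3 → + M ∣ c → Turnable M c

  -- The residues t and t + 1 of c + 1 and c + 2 have distances ρ and ρ′ to multiples of M which
  -- differ by at most one. If neither gives a block pattern, both divide M, so by parity they are
  -- equal, which leaves only M = 3.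
  turnable : ∀ M .{{_ : ℕ.NonZero M}} c → ¬ 2 ℕ.∣ M → Turnable M c
  turnable M c odd with (c + + 1) %ℕ M | residue-∣ M (c + + 1) | n%ℕd<d (c + + 1) M
  ... | zero  | d | _   = shift₁ (shift-∣ (ℤ.+-identityʳ (c + + 1)) d)
  ... | t@(suc t-1) | d | t<M with suc t ℕ.<? M
  ...   | no 1+t≮M = shift₂ (shift-∣ (trans (cong (λ m → c + + 1 - + t + m) M≡) (cancel c (+ t)))
      (∣m∣n⇒∣m+n d ∣-refl))
    where
    M≡ : + M ≡ + 1 + + t
    M≡ = trans (cong +_ (ℕ.≤-antisym (ℕ.≮⇒≥ 1+t≮M) t<M)) (ℤ.pos-+ 1 t)
    cancel : ∀ c t → c + + 1 - t + (+ 1 + t) ≡ c + + 2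
    cancel = solve-∀
  ...   | yes 1+t<M with halve t odd (ℕ.s≤s ℕ.z≤n) t<M | halve (suc t) odd (ℕ.s≤s ℕ.z≤n) 1+t<M
  ...     | ρ , 0<ρ , 2ρ<M , t≡ | ρ′ , 0<ρ′ , 2ρ′<M , t′≡ with ρ ℕ.∣? M | ρ′ ℕ.∣? M
  ...       | no ρ∤M | _ = turn₁ (residue-pattern 0<ρ 2ρ<M t≡ ρ∤M d)
  ...       | yes _ | no ρ′∤M =
      turn₂
      (residue-pattern 0<ρ′ 2ρ′<M t′≡ ρ′∤M
          (shift-∣ (trans (next c (+ t)) (cong (λ m → c + + 2 - m) (sym (ℤ.pos-+ 1 t)))) d))
    where
    next : ∀ c t → c + + 1 - t ≡ c + + 2 - (+ 1 + t)
    next = solve-∀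
  ...       | yes ρ∣M | yes ρ′∣M with t≡ | t′≡
  ...         | inj₁ refl | inj₁ refl = contradiction ρ′∣M (consecutive-divisors ρ odd ρ∣M)
  ...         | inj₂ t+ρ≡M | inj₂ t+ρ′≡M = contradiction ρ∣M
      (subst (λ x → ¬ x ℕ.∣ M) (sym ρ≡) (consecutive-divisors ρ′ odd ρ′∣M))
    where
    ρ≡ : ρ ≡ suc ρ′
    ρ≡ = ℕ.+-cancelˡ-≡ t ρ (suc ρ′) (trans t+ρ≡M (trans (sym t+ρ′≡M) (sym (ℕ.+-suc t ρ′))))
  -- Here t would exceed M / 2 while t + 1 stays below it.
  ...         | inj₂ t+ρ≡M | inj₁ refl = contradiction
      (ℕ.<-trans (ℕ.+-mono-< 2ρ<M 2ρ′<M) (subst₂ ℕ._<_ (cong₂ ℕ._+_ t+ρ≡M t+ρ≡M) (regroup t ρ)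
       (ℕ.m≤m+n _ 1))) (ℕ.<-irrefl refl)
    where
    regroup : ∀ t ρ → suc (t ℕ.+ ρ ℕ.+ (t ℕ.+ ρ)) ℕ.+ 1 ≡ (ρ ℕ.+ ρ) ℕ.+ (suc t ℕ.+ suc t)
    regroup = ℕSolve.solve-∀
  -- M / 2 lies between t and t + 1, so M = 2 ρ + 1 with ρ = ρ′; as ρ divides M, it divides 1.
  ...         | inj₁ refl | inj₂ t+ρ′≡M = degenerate M≡3
      (shift-∣ (trans (cong (λ r → c + + 1 - + r) ρ≡1) (cancel c)) d)
    where
    ρ≡ρ′ : ρ ≡ ρ′
    ρ≡ρ′ = ℕ.≤-antisym
      (ℕ.+-cancelˡ-≤ ρ ρ ρ′ (ℕ.s≤s⁻¹ (subst (suc (ρ ℕ.+ ρ) ℕ.≤_) (sym t+ρ′≡M) 2ρ<M)))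
      (ℕ.+-cancelʳ-≤ ρ′ ρ′ ρ (ℕ.s≤s⁻¹ (subst (suc (ρ′ ℕ.+ ρ′) ℕ.≤_) (sym t+ρ′≡M) 2ρ′<M)))
    M≡ : M ≡ suc (ρ ℕ.+ ρ)
    M≡ = trans (sym t+ρ′≡M) (cong (λ x → suc (ρ ℕ.+ x)) (sym ρ≡ρ′))
    ρ≡1 : ρ ≡ 1
    ρ≡1 = ℕ.∣1⇒≡1 (ℕ.∣m+n∣m⇒∣n (subst (ρ ℕ.∣_) (trans M≡ (ℕ.+-comm 1 (ρ ℕ.+ ρ))) ρ∣M)
        (ℕ.∣m∣n⇒∣m+n ℕ.∣-refl ℕ.∣-refl))
    M≡3 : M ≡ 3
    M≡3 = trans M≡ (cong (λ x → suc (x ℕ.+ x)) ρ≡1)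
    cancel : ∀ c → c + + 1 - + 1 ≡ c
    cancel = solve-∀

  -- Inverses and parity.

  bézout : ∀ x m → ∃ λ w → + m ∣ (w * x - + gcd (∣ x ∣) m)
  bézout x m = let w , d = natural ∣ x ∣ in signed x w d
    where
    natural : ∀ k → ∃ λ w → + m ∣ w * + k - + gcd k m
    natural k with Bézout.identity (gcd-GCD k m)
    ... | Bézout.+- x y e = + x , divides (+ y)
        (trans
        (cong (_- + gcd k m)
            (trans (sym (ℤ.pos-* x k))
                (trans (cong +_ (sym e))
                    (trans (ℤ.pos-+ (gcd k m) (y ℕ.* m)) (cong (_+_ (+ gcd k m)) (ℤ.pos-* y m))))))
                        (cancel (+ gcd k m) (+ y * + m)))
      where
      cancel : ∀ g z → (g + z) - g ≡ z
      cancel = solve-∀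
    ... | Bézout.-+ x y e = - + x , divides (- + y)
        (trans (negate (+ x) (+ k) (+ gcd k m))
        (trans
            (cong -_ (trans (cong (_+_ (+ gcd k m)) (sym (ℤ.pos-* x k)))
                (trans (sym (ℤ.pos-+ (gcd k m) (x ℕ.* k))) (trans (cong +_ e) (ℤ.pos-* y m)))))
                    (ℤ.neg-distribˡ-* (+ y) (+ m))))
      where
      negate : ∀ x k g → - x * k - g ≡ - (g + x * k)
      negate = solve-∀
    signed : ∀ x w → + m ∣ (w * + (∣ x ∣) - + gcd (∣ x ∣) m) → ∃ λ w → + m ∣ (w * x - + gcd (∣ x ∣) m)
    signed (+ k)      w d = w , d
    signed x@(-[1+ k ]) w d = - w , shift-∣ (cong (_- + gcd (suc k) m) (negate w (+ suc k))) d
      where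
      negate : ∀ w k → w * k ≡ - w * - k
      negate = solve-∀

  Coprime : ℕ → ℤ → ℤ → Set
  Coprime m a b = ∀ d → d ℕ.∣ m → + d ∣ a → + d ∣ b → d ≡ 1

  inverse : ∀ m x → (∀ d → d ℕ.∣ m → + d ∣ x → d ≡ 1) → ∃ λ w → + m ∣ w * x - + 1
  inverse m x coprime = let w , d = bézout x m in
    w , shift-∣
        (cong (λ g → w * x - + g)
        (coprime (gcd ∣ x ∣ m) (gcd[m,n]∣n ∣ x ∣ m) (∣ᵤ⇒∣ (gcd[m,n]∣m ∣ x ∣ m)))) d

  nine+six : ∀ e → ¬ 2 ℕ.∣ e → 3 ℕ.∣ e → e ≢ 3 → ∃ λ l → e ≡ 9 ℕ.+ 6 ℕ.* l
  nine+six e odd (ℕ.divides k refl) e≢3 with parity k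
  ... | inj₁ 2∣k = contradiction (ℕ.∣m⇒∣m*n 3 2∣k) odd
  ... | inj₂ (ℕ.divides (suc zero) refl) = contradiction refl e≢3
  ... | inj₂ (ℕ.divides (suc (suc t)) refl) = t , regroup t
    where
    regroup : ∀ t → suc (suc (suc (t ℕ.* 2))) ℕ.* 3 ≡ 9 ℕ.+ 6 ℕ.* t
    regroup = ℕSolve.solve-∀

  parityℤ : ∀ x → (+ 2 ∣ x) ⊎ (+ 2 ∣ x - + 1)
  parityℤ x with x %ℕ 2 | residue-∣ 2 x | n%ℕd<d x 2
  ... | 0 | d | _ = inj₁ (shift-∣ (ℤ.+-identityʳ x) d)
  ... | 1 | d | _ = inj₂ d
  ... | suc (suc _) | _ | ℕ.s≤s (ℕ.s≤s ())

  six-∣ : ∀ {x} → + 2 ∣ x → + 3 ∣ x → + 6 ∣ x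
  six-∣ {x} (divides r e₂) (divides q e₃) = divides (r - q)
    (trans (cancel x) (trans (cong₂ (λ y z → y * + 3 - z * + 2) e₂ e₃) (regroup r q)))
    where
    cancel : ∀ x → x ≡ x * + 3 - x * + 2
    cancel = solve-∀
    regroup : ∀ r q → r * + 2 * + 3 - q * + 3 * + 2 ≡ (r - q) * + 6
    regroup = solve-∀

  -- Schemes on a connected component.

  module _ {m : ℕ} (3∣m : 3 ℕ.∣ m) {a b : ℤ} (a≡1 : + 3 ∣ a - + 1) (b≡1 : + 3 ∣ b - + 1) where

    even-scheme : + 2 ∣ + m → + 2 ∣ b - + 1 → Scheme m a b
    even-scheme 2∣m b-odd with parityℤ a
    ... | inj₁ a-even = scale (+ 1) (six-∣ 2∣m (∣ᵤ⇒∣ 3∣m))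
            (six-∣ (shift-∣ (two a) (∣m∣n⇒∣m+n a-even (divides (+ 1) refl)))
                (shift-∣ (three a) (∣m∣n⇒∣m+n a≡1 (divides (+ 1) refl))))
            (six-∣ (shift-∣ (five b) (∣m∣n⇒∣m+n b-odd (divides (+ 3) refl)))
                (shift-∣ (five b) (∣m∣n⇒∣m+n b≡1 (divides (+ 2) refl))))
            six⁻
      where
      two : ∀ a → a + + 2 ≡ + 1 * a - - + 2
      two = solve-∀
      three : ∀ a → a - + 1 + + 3 ≡ + 1 * a - - + 2
      three = solve-∀
      five : ∀ b → b - + 1 + + 6 ≡ + 1 * b - - + 5
      five = solve-∀
    ... | inj₂ a-odd = scale (+ 1) (six-∣ 2∣m (∣ᵤ⇒∣ 3∣m)) (five a a-odd a≡1) (five b b-odd b≡1) six⁺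
      where
      five : ∀ x → + 2 ∣ x - + 1 → + 3 ∣ x - + 1 → + 6 ∣ + 1 * x - - + 5
      five x d e = six-∣ (shift-∣ (regroup x) (∣m∣n⇒∣m+n d (divides (+ 3) refl)))
          (shift-∣ (regroup x) (∣m∣n⇒∣m+n e (divides (+ 2) refl)))
        where
        regroup : ∀ b → b - + 1 + + 6 ≡ + 1 * b - - + 5
        regroup = solve-∀

  -- A common divisor of m and b divides a ≡ -2 b as well, so b is invertible modulo m;
  -- multiplication by its inverse turns the steps into -2 and 1.
  squared-scheme : ∀ {m a b} → ¬ 2 ℕ.∣ m → 3 ℕ.∣ m → m ≢ 3 → Coprime m a b → + m ∣ a + b + b →
      Scheme m a b
  squared-scheme {m} {a} {b} odd 3∣m m≢3 coprime d
    with l , refl ← nine+six m odd 3∣m m≢3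
    with v , vb≡1 ← inverse m b
        (λ k k∣m k∣b → coprime k k∣m (∣m+n∣n⇒∣m (∣m+n∣n⇒∣m (∣-trans (∣ᵤ⇒∣ k∣m) d) k∣b) k∣b) k∣b)
    = scale v ∣-refl (shift-∣ (regroup v a b) (∣m∣n⇒∣m-n (∣n⇒∣m*n v d) (∣n⇒∣m*n (+ 2) vb≡1))) vb≡1
        (reverse (squaredScheme l))
    where
    regroup : ∀ v a b → v * (a + b + b) - + 2 * (v * b - + 1) ≡ v * a - - + 2
    regroup = solve-∀

  minus-plus : ∀ a b → (a - b) + b ≡ a
  minus-plus = solve-∀

  -- Modulo e both steps agree, so coprimality makes b invertible there; its inverse turns both
  -- steps into 1.
  doubled-scheme : ∀ {m a b} e → e ℕ.∣ m → + e ∣ a - b → ¬ 2 ℕ.∣ e → 3 ℕ.∣ e → e ≢ 3 → Coprime m a b →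
      Scheme m a b
  doubled-scheme {m} {a} {b} e e∣m e∣a-b odd 3∣e e≢3 coprime
    with l , refl ← nine+six e odd 3∣e e≢3
    with v , vb≡1 ← inverse e b (λ k k∣e k∣b → coprime k (ℕ.∣-trans k∣e e∣m)
           (shift-∣ (minus-plus a b) (∣m∣n⇒∣m+n (∣-trans (∣ᵤ⇒∣ k∣e) e∣a-b) k∣b)) k∣b)
    = scale v (∣ᵤ⇒∣ e∣m) (shift-∣ (regroup v a b) (∣m∣n⇒∣m+n vb≡1 (∣n⇒∣m*n v e∣a-b))) vb≡1
        (doubledScheme l)
    where
    regroup : ∀ v a b → (v * b - + 1) + v * (a - b) ≡ v * a - + 1
    regroup = solve-∀

  layered-scheme : ∀ M .{{_ : ℕ.NonZero M}} {a b} → ¬ 2 ℕ.∣ M → M ≢ 1 → Coprime (M ℕ.* 3) a b →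
    + 3 ∣ a - + 1 → + 3 ∣ b - + 1 → ∀ w → + (M ℕ.* 3) ∣ w * (a - b) - + 3 → Scheme (M ℕ.* 3) a b
  layered-scheme M {a} {b} odd M≢1 coprime (divides α a≡) (divides β b≡) w wd = go (turnable M c odd)
    where
    u c : ℤ
    u = α - β
    c = w * (+ 1 + β * + 3)

    plus-minus : ∀ b → + 1 + (b - + 1) ≡ b
    plus-minus = solve-∀

    b′≡ : + 1 + β * + 3 ≡ b
    b′≡ = trans (cong (_+_ (+ 1)) (sym b≡)) (plus-minus b)

    a′≡ : + 1 + α * + 3 ≡ a
    a′≡ = trans (cong (_+_ (+ 1)) (sym a≡)) (plus-minus a)

    a≡b+3u : + 1 + β * + 3 + u * + 3 ≡ a
    a≡b+3u = trans (regroup α β) a′≡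
      where
      regroup : ∀ α β → + 1 + β * + 3 + (α - β) * + 3 ≡ + 1 + α * + 3
      regroup = solve-∀

    b≡a-3u : + 1 + α * + 3 + - u * + 3 ≡ b
    b≡a-3u = trans (regroup α β) b′≡
      where
      regroup : ∀ α β → + 1 + α * + 3 + - (α - β) * + 3 ≡ + 1 + β * + 3
      regroup = solve-∀

    wu≡1 : + M ∣ w * u - + 1
    wu≡1 = *-cancelʳ-∣ (+ 3)
        (subst₂ _∣_ (ℤ.pos-* M 3) (trans (cong (λ x → w * x - + 3) (cong₂ _-_ (sym a′≡) (sym b′≡)))
        (regroup w α β)) wd)
      where
      regroup : ∀ w α β → w * ((+ 1 + α * + 3) - (+ 1 + β * + 3)) - + 3 ≡ (w * (α - β) - + 1) * + 3
      regroup = solve-∀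

    lift : ∀ {x y} → + M ∣ x → x * + 3 ≡ y → + (M ℕ.* 3) ∣ y
    lift d refl = subst (_∣ _) (sym (ℤ.pos-* M 3)) (*-monoˡ-∣ (+ 3) d)

    3∣m : 3 ℕ.∣ M ℕ.* 3
    3∣m = ℕ.divides M refl

    m-odd : ¬ 2 ℕ.∣ M ℕ.* 3
    m-odd d with parity M
    ... | inj₁ 2∣M = odd 2∣M
    ... | inj₂ 2∣1+M = contradiction
        (ℕ.∣⇒≤ (ℕ.∣m+n∣m⇒∣n (subst (2 ℕ.∣_) (regroup M) (ℕ.∣m⇒∣m*n 3 2∣1+M))
        (ℕ.∣m∣n⇒∣m+n d (ℕ.divides 1 refl)))) (ℕ.<⇒≱ (ℕ.s≤s (ℕ.s≤s ℕ.z≤n)))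
      where
      regroup : ∀ M → suc M ℕ.* 3 ≡ M ℕ.* 3 ℕ.+ 2 ℕ.+ 1
      regroup = ℕSolve.solve-∀

    m≢3 : M ℕ.* 3 ≢ 3
    m≢3 e = M≢1 (ℕ.*-cancelʳ-≡ M 1 3 e)

    go : Turnable M c → Scheme (M ℕ.* 3) a b
    go (turn₁ (s , P)) = subst₂ (Scheme _) a≡b+3u b′≡ (layered M w u β wu≡1 P)
    -- Exchanging a and b negates u and w. As w a ≡ w b + 3 w u ≡ c + 3, the displacement becomes 1
    -- - w a ≡ -(c + 2).
    go (turn₂ (s , P)) =
        swap (subst₂ (Scheme _) b≡a-3u a′≡ (layered M (- w) (- u) α (shift-∣ (regroup w u) wu≡1)
        (pattern-cong (shift-∣ (mirror w α β) (∣n⇒∣m*n (+ 3) wu≡1)) (reflect P))))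
      where
      regroup : ∀ w u → w * u - + 1 ≡ - w * - u - + 1
      regroup = solve-∀
      mirror : ∀ w α β →
          + 3 * (w * (α - β) - + 1) ≡ - (w * (+ 1 + β * + 3) + + 2) - (- w * (+ 1 + α * + 3) + + 1)
      mirror = solve-∀
    -- From w b ≡ -1, multiplication by u gives u + b ≡ 0 (mod M); three times this is a + 2 b ≡ 0
    -- (mod 3 M).
    go (shift₁ d) = squared-scheme m-odd 3∣m m≢3 coprime
        (lift (∣m∣n⇒∣m-n (∣n⇒∣m*n u d) (∣m⇒∣m*n (+ 1 + β * + 3) wu≡1))
        (trans (regroup w α β) (cong₂ (λ x y → x + y + y) a′≡ b′≡)))
      where
      regroup : ∀ w α β →
          ((α - β) * (w * (+ 1 + β * + 3) + + 1) - (w * (α - β) - + 1) * (+ 1 + β * + 3)) * + 3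
          ≡ (+ 1 + α * + 3) + (+ 1 + β * + 3) + (+ 1 + β * + 3)
      regroup = solve-∀
    -- Likewise w b ≡ -2 gives 2 u + b ≡ 0 (mod M), and three times this is 2 a + b.
    go (shift₂ d) = swap (squared-scheme m-odd 3∣m m≢3 (λ k p q r → coprime k p r q)
        (lift (∣m∣n⇒∣m-n (∣n⇒∣m*n u d) (∣m⇒∣m*n (+ 1 + β * + 3) wu≡1))
        (trans (regroup w α β) (cong₂ (λ x y → y + x + x) a′≡ b′≡))))
      where
      regroup : ∀ w α β →
          ((α - β) * (w * (+ 1 + β * + 3) + + 2) - (w * (α - β) - + 1) * (+ 1 + β * + 3)) * + 3
          ≡ (+ 1 + β * + 3) + (+ 1 + α * + 3) + (+ 1 + α * + 3)
      regroup = solve-∀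
    -- Modulo 3, w ≡ w b = c ≡ 0, although w is invertible.
    go (degenerate refl d) = contradiction (∣⇒∣ᵤ 3∣1) λ 3∣1 → contradiction (ℕ.∣⇒≤ 3∣1)
        (ℕ.<⇒≱ (ℕ.s≤s (ℕ.s≤s ℕ.z≤n)))
      where
      3∣w : + 3 ∣ w
      3∣w = shift-∣ (regroup w β) (∣m∣n⇒∣m-n d (divides (w * β) refl))
        where
        regroup : ∀ w β → w * (+ 1 + β * + 3) - w * β * + 3 ≡ w
        regroup = solve-∀
      3∣1 : + 3 ∣ + 1
      3∣1 = shift-∣ (regroup (w * u)) (∣m∣n⇒∣m-n (∣m⇒∣m*n u 3∣w) wu≡1)
        where
        regroup : ∀ x → x - (x - + 1) ≡ + 1
        regroup = solve-∀

  coprime-scheme : ∀ m .{{_ : ℕ.NonZero m}} {a b} → 3 ℕ.∣ m → m ≢ 3 → + 3 ∣ a - + 1 → + 3 ∣ b - + 1 →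
      Coprime m a b → Scheme m a b
  coprime-scheme m {a} {b} 3∣m m≢3 a≡1 b≡1 coprime with 2 ℕ.∣? m
  ... | yes 2∣m with parityℤ b | parityℤ a
  ...   | inj₂ b-odd | _ = even-scheme 3∣m a≡1 b≡1 (∣ᵤ⇒∣ 2∣m) b-odd
  ...   | inj₁ _ | inj₂ a-odd = swap (even-scheme 3∣m b≡1 a≡1 (∣ᵤ⇒∣ 2∣m) a-odd)
  ...   | inj₁ b-even | inj₁ a-even with () ← coprime 2 2∣m a-even b-even
  coprime-scheme m {a} {b} 3∣m m≢3 a≡1 b≡1 coprime | no odd with gcd (∣ a - b ∣) m ℕ.≟ 3
  ... | no e≢3 = doubled-scheme (gcd (∣ a - b ∣) m) e∣m (∣ᵤ⇒∣ (gcd[m,n]∣m (∣ a - b ∣) m))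
        (λ 2∣e → odd (ℕ.∣-trans 2∣e e∣m)) (gcd-greatest (∣⇒∣ᵤ 3∣a-b) 3∣m) e≢3 coprime
    where
    e∣m = gcd[m,n]∣n (∣ a - b ∣) m
    3∣a-b : + 3 ∣ a - b
    3∣a-b = shift-∣ (cancel a b) (∣m∣n⇒∣m-n a≡1 b≡1)
      where
      cancel : ∀ a b → (a - + 1) - (b - + 1) ≡ a - b
      cancel = solve-∀
  ... | yes e≡3 with ℕ.divides M refl ← 3∣m = layered-scheme M {{ℕ.m*n≢0⇒m≢0 M}}
      (λ 2∣M → odd (ℕ.∣m⇒∣m*n 3 2∣M)) (λ M≡1 → m≢3 (cong (ℕ._* 3) M≡1)) coprime a≡1 b≡1
        (bézout (a - b) m .proj₁) (shift-∣ (cong (λ e → bézout (a - b) m .proj₁ * (a - b) - + e) e≡3)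
            (bézout (a - b) m .proj₂))

  -- From components to the whole graph.

  -- Division by g maps every coset of g ℤ to ℤ and carries the steps a g and b g to a and b.
  dilate : ∀ m g .{{_ : ℕ.NonZero g}} {a b} → Scheme m a b → Scheme (m ℕ.* g) (a * + g) (b * + g)
  dilate m g {a} {b} = pullback (_/ℕ g) (λ {x} {y} → cong-/ x y) (step a) (step b)
    where
    quotient-≡ : ∀ z i q → z ≡ + (i %ℕ g) + q * + g → z /ℕ g ≡ q
    quotient-≡ z i q e = divMod-unique g {q = q} (n%ℕd<d i g) e .proj₂
    cong-/ : ∀ x y → + (m ℕ.* g) ∣ x - y → + m ∣ x /ℕ g - y /ℕ g
    cong-/ x y (divides k e) = divides k (trans (cong (_- y /ℕ g) (quotient-≡ x y (k * + m + y /ℕ g)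
        (trans (sym (minus-plus x y))
            (trans (cong₂ _+_ (trans e (cong (k *_) (ℤ.pos-* m g))) (a≡a%ℕn+[a/ℕn]*n y g))
            (regroup k (+ m) (+ (y %ℕ g)) (y /ℕ g) (+ g))))))
        (cancel (k * + m) (y /ℕ g)))
      where
      regroup : ∀ k m r q g → k * (m * g) + (r + q * g) ≡ r + (k * m + q) * g
      regroup = solve-∀
      cancel : ∀ k q → (k + q) - q ≡ k
      cancel = solve-∀
    step : ∀ a x → + m ∣ (x - a * + g) /ℕ g - (x /ℕ g - a)
    step a x = divides 0ℤ (ℤ.i≡j⇒i-j≡0 (quotient-≡ (x - a * + g) x (x /ℕ g - a)
        (trans (cong (_- a * + g) (a≡a%ℕn+[a/ℕn]*n x g)) (regroup (+ (x %ℕ g)) (x /ℕ g) a (+ g)))))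
      where
      regroup : ∀ r q a g → (r + q * g) - a * g ≡ r + (q - a) * g
      regroup = solve-∀

  -- A step and its negative generate the same edges, so the residue 2 can be traded for 1.
  normalise : ∀ a → ¬ 3 ℕ.∣ a → ∃ λ x → (+ 3 ∣ x - + 1) × (x ≡ + a ⊎ x ≡ - + a)
  normalise a 3∤a with a ℕ.% 3 in eq | residue-∣ 3 (+ a) | ℕ.m%n<n a 3
  ... | 0 | d | _ = contradiction (ℕ.m%n≡0⇒n∣m a 3 eq) 3∤a
  ... | 1 | d | _ = + a , d , inj₁ refl
  ... | 2 | d | _ = - + a , shift-∣ (regroup (+ a)) (∣m∣n⇒∣m-n (∣m⇒∣-m d) (∣-refl {+ 3})) , inj₂ refl
    where
    regroup : ∀ a → - (a - + 2) - + 3 ≡ - a - + 1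
    regroup = solve-∀
  ... | suc (suc (suc _)) | _ | ℕ.s≤s (ℕ.s≤s (ℕ.s≤s ()))

  unsign : ∀ {m a b x} → x ≡ + a ⊎ x ≡ - + a → Scheme m x b → Scheme m (+ a) b
  unsign (inj₁ refl) s = s
  unsign {a = a} (inj₂ refl) s = subst (λ x → Scheme _ x _) (ℤ.neg-involutive (+ a)) (reverse s)

  signed-∣ : ∀ {a x d} → x ≡ + a ⊎ x ≡ - + a → + d ∣ x → d ℕ.∣ a
  signed-∣ (inj₁ refl) d = ∣⇒∣ᵤ d
  signed-∣ {a} (inj₂ refl) d = ∣⇒∣ᵤ (shift-∣ (ℤ.neg-involutive (+ a)) (∣m⇒∣-m d))

  positive-scheme : ∀ m .{{_ : ℕ.NonZero m}} a b → 3 ℕ.∣ m → m ≢ 3 → ¬ 3 ℕ.∣ a → ¬ 3 ℕ.∣ b →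
    (∀ d → d ℕ.∣ m → d ℕ.∣ a → d ℕ.∣ b → d ≡ 1) → Scheme m (+ a) (+ b)
  positive-scheme m a b 3∣m m≢3 3∤a 3∤b coprime
    with x , x≡1 , x≡a ← normalise a 3∤a | y , y≡1 , y≡b ← normalise b 3∤b =
    unsign x≡a (swap (unsign y≡b (swap (coprime-scheme m 3∣m m≢3 x≡1 y≡1
      (λ d d∣m d∣x d∣y → coprime d d∣m (signed-∣ x≡a d∣x) (signed-∣ y≡b d∣y))))))

  -- With g = gcd (a, b, n), the graph consists of g copies of C_m(a′, b′), where n = m g, a = a′ g
  -- and b = b′ g.
  circulant-scheme : ∀ n a b → 0 ℕ.< a → a ℕ.< b → b ℕ.+ b ℕ.< n → 3 ℕ.∣ n → ¬ 3 ℕ.∣ a → ¬ 3 ℕ.∣ b →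
    Scheme n (+ a) (+ b)
  circulant-scheme n a b 0<a a<b 2b<n 3∣n 3∤a 3∤b
    with gcd (gcd a b) n | ℕ.∣-trans (gcd[m,n]∣m (gcd a b) n) (gcd[m,n]∣m a b)
       | ℕ.∣-trans (gcd[m,n]∣m (gcd a b) n) (gcd[m,n]∣n a b) | gcd[m,n]∣n (gcd a b) n
       | (λ {d} (d∣a : d ℕ.∣ a) d∣b → gcd-greatest {gcd a b} {n} (gcd-greatest d∣a d∣b))
  ... | g | ℕ.divides a′ refl | ℕ.divides b′ refl | ℕ.divides m refl | greatest =
    subst₂ (Scheme (m ℕ.* g)) (sym (ℤ.pos-* a′ g)) (sym (ℤ.pos-* b′ g)) (dilate m g
      (positive-scheme m a′ b′ 3∣m m≢3 (λ d → 3∤a (ℕ.∣m⇒∣m*n g d)) (λ d → 3∤b (ℕ.∣m⇒∣m*n g d)) coprime))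
    where
    instance
      g≢0 : ℕ.NonZero g
      g≢0 = ℕ.m*n≢0⇒n≢0 a′ {{ℕ.>-nonZero 0<a}}
      m≢0 : ℕ.NonZero m
      m≢0 = ℕ.m*n≢0⇒m≢0 m {{ℕ.>-nonZero (ℕ.≤-<-trans ℕ.z≤n 2b<n)}}
    3∣m : 3 ℕ.∣ m
    3∣m with euclidsLemma m g (from-yes (prime? 3)) 3∣n
    ... | inj₁ d = d
    -- g divides a, so 3 cannot divide g.
    ... | inj₂ d = contradiction (ℕ.∣n⇒∣m*n a′ d) 3∤a
    m≢3 : m ≢ 3
    -- 1 ≤ a′ < b′ forces 2 b′ ≥ 4, whereas 2 b′ < m.
    m≢3 refl = ℕ.<⇒≱ 2b′<3 (ℕ.≤-trans (ℕ.n≤1+n 3) (ℕ.+-mono-≤ 2≤b′ 2≤b′))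
      where
      2b′<3 : b′ ℕ.+ b′ ℕ.< 3
      2b′<3 = ℕ.*-cancelʳ-< g (b′ ℕ.+ b′) 3 (subst (ℕ._< 3 ℕ.* g) (sym (ℕ.*-distribʳ-+ g b′ b′)) 2b<n)
      2≤b′ : 2 ℕ.≤ b′
      2≤b′ = ℕ.≤-<-trans (ℕ.*-cancelʳ-< g 0 a′ 0<a) (ℕ.*-cancelʳ-< g a′ b′ a<b)
    coprime : ∀ d → d ℕ.∣ m → d ℕ.∣ a′ → d ℕ.∣ b′ → d ≡ 1
    coprime d d∣m d∣a d∣b = ℕ.∣1⇒≡1 (ℕ.*-cancelʳ-∣ g (subst (d ℕ.* g ℕ.∣_) (sym (ℕ.*-identityˡ g))
      (greatest (ℕ.*-monoˡ-∣ g d∣a) (ℕ.*-monoˡ-∣ g d∣b) (ℕ.*-monoˡ-∣ g d∣m))))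

  typeI : ∀ p a b → 1 ℕ.≤ p → 1 ℕ.≤ a → a ℕ.< b → b ℕ.≤ (6 ℕ.* p ℕ.∸ 1) ℕ./ 2 → a ℕ.% 3 ≢ 0 →
      b ℕ.% 3 ≢ 0 →
    TypeI₄ (6 ℕ.* p) a b
  typeI p@(suc _) a b _ 1≤a a<b b≤ a%3 b%3 = Circulant.scheme⇒typeI _ a b 1≤a a<b 2b<n
    (circulant-scheme (6 ℕ.* p) a b 1≤a a<b 2b<n (ℕ.∣m⇒∣m*n p (ℕ.divides 2 refl))
      (λ d → a%3 (ℕ.n∣m⇒m%n≡0 a 3 d)) (λ d → b%3 (ℕ.n∣m⇒m%n≡0 b 3 d)))
    where
    2b<n : b ℕ.+ b ℕ.< 6 ℕ.* p
    2b<n = ℕ.s≤s (ℕ.≤-trans (ℕ.≤-reflexive (trans (cong (b ℕ.+_) (sym (ℕ.+-identityʳ b))) (ℕ.*-comm 2 b)))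
      (ℕ.≤-trans (ℕ.*-monoˡ-≤ 2 b≤) (ℕ.m/n*n≤m (6 ℕ.* p ℕ.∸ 1) 2)))

open Construction using (typeI)
open import Data.Nat using (ℕ; suc; _*_; _∸_; _/_; _%_; _≤_; _<_)
open import Data.Nat.GCD using (gcd)
open import Data.Product using (_×_; _,_)
open import Relation.Binary.PropositionalEquality using (_≡_; _≢_)

theorem2p4 : (p a b : ℕ) → 1 ≤ p → 1 ≤ a → a < b → b ≤ (6 * p ∸ 1) / 2 →
    a % 3 ≢ 0 → b % 3 ≢ 0 →
    (p % 2 ≡ 0 → TypeI₄ (6 * p) a b)
    × (p % 2 ≡ 1 → gcd a b ≡ 1 → TypeI₄ (6 * p) a b)
theorem2p4 p a b 1≤p 1≤a a<b b≤ a%3≢0 b%3≢0 =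
  (λ _ → typeI p a b 1≤p 1≤a a<b b≤ a%3≢0 b%3≢0) ,
  (λ _ _ → typeI p a b 1≤p 1≤a a<b b≤ a%3≢0 b%3≢0)
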